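{- For every $F\in\mathbb{N}$ and $L\in[1,\infty)$ there are real constants $E,E'''>0$ such that the following holds. Let $R$ be a commutative ring, let $(X,w)$ be a properly weighted $R$-oriented $d$-poset ($d\ge1$) such that $L(X)\le L$ and every $1$-face of $X$ contains at most $F$ $0$-faces. Let $\mathcal{F}$ be an $R$-sheaf on $X$ and let $\varepsilon,\alpha,\beta\in[0,\infty)$. Suppose that (1) $\mathrm{cbe}_{ -1}(X_v,w_v,\mathcal{F}_v)\ge\varepsilon$ for every $v\in X(0)$, and (2) $\mathrm{Gr}(X,w)$ is an $(\alpha,\beta)$-skeleton expander. Then $\mathrm{ccd}_0(X,w,\mathcal{F})\ge\frac{E'''(E\varepsilon-\alpha)}{\beta}$ (where the quotient is understood for $\beta>0$). One may take $E=L^{ -8}$ and $E'''=L^{ -3}$; in particular $E=E'''=1$ when $X$ is lower-regular.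
   Context: **Posets.** All posets are finite; $x\lhd y$ means $x<y$ with no element strictly between. A graded poset is a poset $X$ with $\dim:X\to\mathbb{Z}$ such that $x\le y$ implies $\dim x\le\dim y$ and $x\lhd y$ implies $\dim y=\dim x+1$. Put $X(i)=\{x\in X:\dim x=i\}$ ($i$-faces), $x(i)=\{y\in X(i):y\le x\}$, and $A_x=\{a\in A:a\ge x\}$ for $A\subseteq X$. A $d$-poset ($d\ge 0$) is a nonempty graded poset in which every face is $\le$ some $d$-face and which has a face $\emptyset_X$ with $\dim\emptyset_X=-1$ and $\emptyset_X\le x$ for all $x$. **Lower irregularity.** For $i\le j\le k$, $F^{\max}_{i,j,k}$ (resp. $F^{\min}_{i,j,k}$) is the maximal (resp. minimal) number of $y\in X(j)$ with $x\le y\le z$, over all $x\in X(i)$, $z\in X(k)$ with $x\le z$. $L(X)=\max_{ -1\le i\le j\le k\le d}F^{\max}_{i,j,k}/F^{\min}_{i,j,k}$; $X$ is lower-regular if $L(X)=1$. **Weights and links.** A proper weight function on a $d$-poset $X$ is $w:X\to\mathbb{R}_+$ (positive reals) with $\sum_{y\in X(d)}w(y)=1$ and $w(x)=\sum_{y\in X(d),\,y\ge x}w(y)/|y(i)|$ for all $x\in X(i)$ and all $i$. For $A\subseteq X$, $w(A)=\sum_{a\in A}w(a)$. For $z\in X$ the link is $X_z=\{x\in X:x\ge z\}$ with $\dim_{X_z}x=\dim x-\dim z-1$, given the proper weight function $w_z(x)=\frac{1}{w(X(d)_z)}\sum_{y\in X(d)_x}\frac{w(y)}{\#\{x'\in X(\dim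 x):z\le x'\le y\}}$. **Orientation, sheaves, cohomology.** An $R$-orientation on $X$ assigns $[y:x]\in R^\times$ to each $x\lhd y$ so that $\sum_{y:x<y<z}[z:y][y:x]=0$ whenever $x\le z$ and $\dim z=\dim x+2$; links carry the restricted orientation. An $R$-sheaf $\mathcal{F}$ on $X$ consists of $R$-modules $\mathcal{F}(x)$ and $R$-linear maps $\mathrm{res}_{y\leftarrow x}:\mathcal{F}(x)\to\mathcal{F}(y)$ ($x<y$) with $\mathrm{res}_{z\leftarrow y}\circ\mathrm{res}_{y\leftarrow x}=\mathrm{res}_{z\leftarrow x}$ for $x<y<z$; $\mathcal{F}_z$ is its restriction to $X_z$. $C^i=C^i(X,\mathcal{F})=\prod_{x\in X(i)}\mathcal{F}(x)$; $(d_if)(y)=\sum_{x\in y(i)}[y:x]\,\mathrm{res}_{y\leftarrow x}f(x)$ for $f\in C^i$, $y\in X(i+1)$; $Z^i=\ker d_i$, $B^i=\mathrm{im}\,d_{i-1}$. **Expansion.** $\|f\|_w=w(\{x:f(x)\ne0\})$, $\mathrm{dist}_w(f,g)=\|f-g\|_w$. $\mathrm{cbe}_i(X,w,\mathcal{F})$ is the supremum of the $\mu\ge 0$ with $\|d_if\|_w\ge\mu\,\mathrm{dist}_w(f,B^i)$ for all $f\in C^i$; $\mathrm{ccd}_i(X,w,\mathcal{F})=\inf\{\|f\|_w:f\in Z^i\setminus B^i\}$. $\mathrm{Gr}(X,w)$ is the weighted hypergraph with vertices $X(0)$, hyperedges $X(1)$; it is an $(\alpha,\beta)$-skeleton expander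 if for all $A\subseteq X(0)$ the total weight of the $e\in X(1)$ having at least two distinct vertices in $A$ is at most $\alpha w(A)+\beta w(A)^2$. -}

module Defs where

open import Algebra.Bundles using (CommutativeRing; Semiring)
open import Algebra.Bundles.Raw using (RawMonoid)
open import Algebra.Definitions using (Invertible)
import Algebra.Definitions.RawSemiring
open import Algebra.Module.Bundles using (Module)
open import Algebra.Module.Morphism.Structures using (module ModuleMorphisms)
open import Axiom.ExcludedMiddle using (ExcludedMiddle)
open import Data.Empty.Irrelevant using (⊥-elim)
open import Data.Integer.Base as ℤ using (ℤ; +_; -1ℤ; 0ℤ; 1ℤ)
import Data.Integer.Properties as ℤ
open import Data.Irrelevant as Irrelevant using (Irrelevant; [_])
open import Data.List.Base using (List; []; _∷_; cartesianProduct; filter; foldr; length; map; upTo)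
import Data.List.Extrema
import Data.List.Extrema.Nat as ℕ-Extrema
open import Data.List.Membership.Propositional using (_∈_)
open import Data.List.Relation.Unary.Any using (here; there)
open import Data.List.Relation.Unary.Unique.Propositional using (Unique)
import Data.List.Relation.Unary.Unique.Propositional.Properties as Unique
open import Data.Nat.Base as ℕ using (ℕ)
open import Data.Product.Base using (Σ-syntax; ∃; ∃-syntax; _×_; _,_; proj₁; proj₂)
open import Data.Refinement using (Refinement; Refinement-syntax; _,_; value; value-injective)
open import Level using (Level; Setω; _⊔_; suc; 0ℓ)
open import Relation.Binary.Bundles using (TotalOrder)
open import Relation.Binary.Core using (Rel)
import Relation.Binary.Construct.NonStrictToStrict as NonStrictToStrict
import Relation.Binary.Construct.Add.Supremum.NonStrict as Supremum
open import Relation.Binary.PropositionalEquality using (_≡_; _≢_; refl; sym; trans; cong; isEquivalence; subst)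
open import Relation.Binary.Structures using (IsPartialOrder; IsTotalOrder)
open import Relation.Nullary using (¬_; yes; no)
open import Relation.Nullary.Construct.Add.Supremum using (_⁺; [_]; ⊤⁺)
open import Relation.Unary using (Pred; Decidable; Satisfiable)

private
  variable
    a ℓ p c ℓ₁ ℓ₂ r ℓr m ℓm : Level
    A : Set a

module Bounds {A : Set a} (_≤_ : Rel A ℓ) where

  IsUpperBound : Pred A p → Pred A _
  IsUpperBound S u = ∀ x → S x → x ≤ u

  BoundedAbove : Pred A p → Set _
  BoundedAbove S = ∃ (IsUpperBound S)

  IsSupremum : Pred A p → Pred A _
  IsSupremum S s = IsUpperBound S s × (∀ u → IsUpperBound S u → s ≤ u)

-- The real numbers, characterised up to isomorphism as a complete ordered
-- field.
record CompleteOrderedField c ℓ₁ ℓ₂ : Setω where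
  infix 4 _≤_
  field
    commutativeRing : CommutativeRing c ℓ₁

  open CommutativeRing commutativeRing public

  field
    _≤_          : Rel Carrier ℓ₂
    isTotalOrder : IsTotalOrder _≈_ _≤_
    0≉1          : 0# ≉ 1#
    invertible   : ∀ {x} → x ≉ 0# → Invertible _≈_ 1# _*_ x
    +-monoˡ-≤    : ∀ z {x y} → x ≤ y → x + z ≤ y + z
    *-nonNeg     : ∀ {x y} → 0# ≤ x → 0# ≤ y → 0# ≤ x * y

  open Bounds _≤_ public

  field
    complete : ∀ {p} (S : Pred Carrier p) → Satisfiable S → BoundedAbove S →
               ∃ (IsSupremum S)

  open NonStrictToStrict _≈_ _≤_ public using (_<_)

  totalOrder : TotalOrder c ℓ₁ ℓ₂
  totalOrder = record { isTotalOrder = isTotalOrder }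

  open Algebra.Definitions.RawSemiring (Semiring.rawSemiring semiring) public
    using (_^_) renaming (_×_ to _×ℕ_)

-- Finite posets carry an explicit duplicate-free enumeration.
record GradedPoset a ℓ : Set (suc (a ⊔ ℓ)) where
  infix 4 _≼_ _⋖_
  field
    Face           : Set a
    _≼_            : Rel Face ℓ
    isPartialOrder : IsPartialOrder _≡_ _≼_
    faces          : List Face
    faces-complete : ∀ x → x ∈ faces
    faces-unique   : Unique faces
    dim            : Face → ℤ

  open NonStrictToStrict _≡_ _≼_ public using () renaming (_<_ to _≺_)

  _⋖_ : Rel Face (a ⊔ ℓ)
  x ⋖ y = x ≺ y × (∀ z → ¬ (x ≺ z × z ≺ y))

  field
    dim-mono : ∀ {x y} → x ≼ y → dim x ℤ.≤ dim y
    dim-⋖    : ∀ {x y} → x ⋖ y → dim y ≡ ℤ.suc (dim x)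

  _⟨_⟩ : Face → ℤ → Pred Face ℓ
  (y ⟨ i ⟩) x = dim x ≡ i × x ≼ y

  ≼⇒≺ : ∀ {x y i} → dim x ≡ i → dim y ≡ ℤ.suc i → x ≼ y → x ≺ y
  ≼⇒≺ dx dy x≼y = x≼y , λ x≡y → ℤ.i≢suc[i] (trans (sym dx) (trans (cong dim x≡y) dy))

record IsDPoset (d : ℕ) (X : GradedPoset a ℓ) : Set (a ⊔ ℓ) where
  open GradedPoset X
  field
    ∅       : Face
    dim-∅   : dim ∅ ≡ -1ℤ
    ∅-least : ∀ x → ∅ ≼ x
    pure    : ∀ x → ∃[ y ] dim y ≡ + d × x ≼ y

-- res takes its argument x ≺ y irrelevantly, so it depends only on x and y.
record Sheaf (R : CommutativeRing r ℓr) (X : GradedPoset a ℓ) m ℓm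
             : Set (r ⊔ ℓr ⊔ a ⊔ ℓ ⊔ suc (m ⊔ ℓm)) where
  open GradedPoset X
  open Module using (Carrierᴹ; rawModule)
  field
    stalk : Face → Module R m ℓm
    res   : ∀ {x y} → .(x ≺ y) → Carrierᴹ (stalk x) → Carrierᴹ (stalk y)
    res-linear : ∀ {x y} .(x≺y : x ≺ y) →
      ModuleMorphisms.IsModuleHomomorphism (rawModule (stalk x)) (rawModule (stalk y)) (res x≺y)
    res-∘ : ∀ {x y z} .(x≺y : x ≺ y) .(y≺z : y ≺ z) .(x≺z : x ≺ z) s →
      Module._≈ᴹ_ (stalk z) (res y≺z (res x≺y s)) (res x≺z s)

  Section : Face → Set m
  Section x = Carrierᴹ (stalk x)

enumerate : {P : Pred A p} → Decidable P → List A → List [ x ∈ A ∣ P x ]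
enumerate P? [] = []
enumerate P? (x ∷ xs) with P? x
... | yes px = (x , [ px ]) ∷ enumerate P? xs
... | no  _  = enumerate P? xs

map-value-enumerate : {P : Pred A p} (P? : Decidable P) (xs : List A) →
                      map value (enumerate P? xs) ≡ filter P? xs
map-value-enumerate P? [] = refl
map-value-enumerate P? (x ∷ xs) with P? x
... | yes _ = cong (x ∷_) (map-value-enumerate P? xs)
... | no  _ = map-value-enumerate P? xs

∈-enumerate : {P : Pred A p} (P? : Decidable P) {xs : List A} (x : [ x ∈ A ∣ P x ]) →
              value x ∈ xs → x ∈ enumerate P? xs
∈-enumerate P? {y ∷ _} (_ , [ px ]) (here refl) with P? y
... | yes _  = here refl
... | no ¬py = ⊥-elim (¬py px)
∈-enumerate P? {y ∷ _} x (there x∈xs) with P? y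
... | yes _ = there (∈-enumerate P? x x∈xs)
... | no  _ = ∈-enumerate P? x x∈xs

enumerate-unique : {P : Pred A p} (P? : Decidable P) {xs : List A} →
                   Unique xs → Unique (enumerate P? xs)
enumerate-unique P? {xs} uniq =
  Unique.map⁻ (subst Unique (sym (map-value-enumerate P? xs)) (Unique.filter⁺ P? uniq))

sumOver : (M : RawMonoid c ℓ) → List A → (A → RawMonoid.Carrier M) → RawMonoid.Carrier M
sumOver M xs f = foldr (λ x s → f x ∙ s) ε xs
  where open RawMonoid M

-- The mathematics is classical, so excluded middle is a parameter.
module Expansion (lem : ∀ {p} → ExcludedMiddle p) (ℝ : CompleteOrderedField c ℓ₁ ℓ₂) where

  open CompleteOrderedField ℝ public
    using (_≈_; _≤_; _<_; _+_; _*_; _-_; _^_; 0#; 1#)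
    renaming (Carrier to Real)
  open CompleteOrderedField ℝ
    using (_≉_; _×ℕ_; BoundedAbove; complete; invertible; totalOrder; +-rawMonoid)
  open Supremum _≤_ public using (_≤⁺_)

  infix  8 _⁻¹
  infixl 7 _/_

  -- 0⁻¹ = 0 by convention.
  _⁻¹ : Real → Real
  x ⁻¹ with lem {P = x ≉ 0#}
  ... | yes x≉0 = proj₁ (invertible x≉0)
  ... | no  _   = 0#

  _/_ : Real → Real → Real
  x / y = x * y ⁻¹

  fromℕ : ℕ → Real
  fromℕ n = n ×ℕ 1#

  -- ⋁ S is the supremum when S is nonempty and bounded above; otherwise it is
  -- the junk value 0, and similarly for the infimum ⋀ S.
  ⋁ : Pred Real p → Real
  ⋁ S with lem {P = Satisfiable S × BoundedAbove S}
  ... | yes (nonempty , bounded) = proj₁ (complete S nonempty bounded)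
  ... | no  _                    = 0#

  ⋀ : Pred Real p → Real
  ⋀ S = ⋁ (λ l → ∀ x → S x → l ≤ x)

  -- Supremum and infimum in [0,∞] of subsets of [0,∞).  sup⁺ is only used for
  -- nonempty sets.
  sup⁺ : Pred Real p → Real ⁺
  sup⁺ S with lem {P = BoundedAbove S}
  ... | yes _ = [ ⋁ S ]
  ... | no  _ = ⊤⁺

  inf⁺ : Pred Real p → Real ⁺
  inf⁺ S with lem {P = Satisfiable S}
  ... | yes _ = [ ⋀ S ]
  ... | no  _ = ⊤⁺

  module _ (X : GradedPoset a ℓ) where
    open GradedPoset X

    select : Pred Face p → List Face
    select P = filter (λ x → lem {P = P x}) faces

    ∣_∣ : Pred Face p → ℕ
    ∣ P ∣ = length (select P)

    ∑ : Pred Face p → (Face → Real) → Real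
    ∑ P = sumOver +-rawMonoid (select P)

    -- In a d-poset the family chainCounts i j k is nonempty and positive for
    -- -1 ≤ i ≤ j ≤ k ≤ d.  All counts lie between 0 and length faces, so these
    -- base values of max and min do not affect Fmax and Fmin, and the
    -- quotients below have nonzero denominators.
    chainCounts : (i j k : ℤ) → List ℕ
    chainCounts i j k =
      map (λ (x , z) → ∣ (λ y → dim y ≡ j × x ≼ y × y ≼ z) ∣)
          (filter (λ (x , z) → lem {P = dim x ≡ i × dim z ≡ k × x ≼ z})
                  (cartesianProduct faces faces))

    Fmax Fmin : (i j k : ℤ) → ℕ
    Fmax i j k = ℕ-Extrema.max 0 (chainCounts i j k)
    Fmin i j k = ℕ-Extrema.min (length faces) (chainCounts i j k)

    lowerIrregularity : ℕ → Real
    lowerIrregularity d =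
      max 0# (map (λ (i , j , k) → fromℕ (Fmax i j k) / fromℕ (Fmin i j k))
                  (filter (λ (i , j , k) → lem {P = i ℤ.≤ j × j ℤ.≤ k})
                          (cartesianProduct dims (cartesianProduct dims dims))))
      where
      open Data.List.Extrema totalOrder using (max)

      -- -1, 0, …, d
      dims : List ℤ
      dims = map (λ n → ℤ.pred (+ n)) (upTo (2 ℕ.+ d))

    LowerRegular : ℕ → Set ℓ₁
    LowerRegular d = lowerIrregularity d ≈ 1#

    record IsProperWeight (d : ℕ) (w : Face → Real) : Set (a ⊔ ℓ₁ ⊔ ℓ₂) where
      field
        positive   : ∀ x → 0# < w x
        normalized : ∑ (λ y → dim y ≡ + d) w ≈ 1#
        w-≈        : ∀ x → w x ≈
          ∑ (λ y → dim y ≡ + d × x ≼ y) (λ y → w y / fromℕ ∣ y ⟨ dim x ⟩ ∣)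

    weight : (Face → Real) → Pred Face p → Real
    weight w A = ∑ A w

    -- Subsets A at the lowest universe level: by excluded middle every
    -- predicate is equivalent to one of these.
    SkeletonExpander : (w : Face → Real) (α β : Real) → Set (a ⊔ ℓ₂ ⊔ suc 0ℓ)
    SkeletonExpander w α β =
      (A : Pred Face 0ℓ) → (∀ x → A x → dim x ≡ 0ℤ) →
      weight w (λ e → dim e ≡ 1ℤ ×
                      (∃[ x ] ∃[ y ] x ≢ y × A x × A y × x ≼ e × y ≼ e))
        ≤ α * weight w A + β * weight w A ^ 2

    link : Face → GradedPoset (a ⊔ ℓ) ℓ
    link z = record
      { Face           = [ x ∈ Face ∣ z ≼ x ]
      ; _≼_            = λ x y → value x ≼ value y
      ; isPartialOrder = record
        { isPreorder = record
          { isEquivalence = isEquivalence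
          ; reflexive     = λ { refl → ≼.refl }
          ; trans         = ≼.trans
          }
        ; antisym = λ x≼y y≼x → value-injective (≼.antisym x≼y y≼x)
        }
      ; faces          = enumerate z≼? faces
      ; faces-complete = λ x → ∈-enumerate z≼? x (faces-complete (value x))
      ; faces-unique   = enumerate-unique z≼? faces-unique
      ; dim            = λ x → dim (value x) ℤ.- dim z ℤ.- 1ℤ
      ; dim-mono       = λ x≼y → ℤ.+-monoˡ-≤ (ℤ.- 1ℤ) (ℤ.+-monoˡ-≤ (ℤ.- dim z) (dim-mono x≼y))
      ; dim-⋖          = λ {x} {y} x⋖y → trans
          (cong (λ i → i ℤ.- dim z ℤ.- 1ℤ) (dim-⋖ (⋖-value x y x⋖y)))
          (trans (cong (ℤ._- 1ℤ) (ℤ.+-assoc 1ℤ (dim (value x)) (ℤ.- dim z)))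
                 (ℤ.+-assoc 1ℤ (dim (value x) ℤ.- dim z) (ℤ.- 1ℤ)))
      }
      where
      module ≼ = IsPartialOrder isPartialOrder

      z≼? : Decidable (z ≼_)
      z≼? x = lem

      _≺ᶻ_ : Rel [ x ∈ Face ∣ z ≼ x ] (a ⊔ ℓ)
      x ≺ᶻ y = value x ≼ value y × x ≢ y

      ⋖-value : ∀ x y → x ≺ᶻ y × (∀ u → ¬ (x ≺ᶻ u × u ≺ᶻ y)) → value x ⋖ value y
      ⋖-value (x , z≼x) y ((x≼y , x≢y) , none) =
        (x≼y , λ eq → x≢y (value-injective eq)) ,
        λ u ((x≼u , x≢u) , (u≼y , u≢y)) →
          none (u , Irrelevant.map (λ q → ≼.trans q x≼u) z≼x)
               ((x≼u , λ eq → x≢u (cong value eq)) , (u≼y , λ eq → u≢y (cong value eq)))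

    linkWeight : ℕ → (Face → Real) → (z : Face) → GradedPoset.Face (link z) → Real
    linkWeight d w z (x , _) =
      weight w (λ y → dim y ≡ + d × z ≼ y) ⁻¹ *
      ∑ (λ y → dim y ≡ + d × x ≼ y)
        (λ y → w y / fromℕ ∣ (λ u → dim u ≡ dim x × z ≼ u × u ≼ y) ∣)

  -- inc y x is [y:x].  It is total for convenience; only its values at
  -- covering pairs x ⋖ y are constrained, and only those enter the
  -- coboundary maps.
  Incidence : CommutativeRing r ℓr → GradedPoset a ℓ → Set (r ⊔ a)
  Incidence R X = GradedPoset.Face X → GradedPoset.Face X → CommutativeRing.Carrier R

  record IsOrientation (R : CommutativeRing r ℓr) (X : GradedPoset a ℓ)
                       (inc : Incidence R X) : Set (r ⊔ ℓr ⊔ a ⊔ ℓ) where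
    open GradedPoset X
    private module R = CommutativeRing R
    field
      unit    : ∀ {x y} → x ⋖ y → Invertible R._≈_ R.1# R._*_ (inc y x)
      inc-sum : ∀ {x z} → x ≼ z → dim z ≡ dim x ℤ.+ + 2 →
        sumOver R.+-rawMonoid (select X (λ y → x ≺ y × y ≺ z))
                (λ y → inc z y R.* inc y x) R.≈ R.0#

  module _ {R : CommutativeRing r ℓr} (X : GradedPoset a ℓ) where
    open GradedPoset X

    linkIncidence : Incidence R X → ∀ z → Incidence R (link X z)
    linkIncidence inc z y x = inc (value y) (value x)

    linkSheaf : Sheaf R X m ℓm → ∀ z → Sheaf R (link X z) m ℓm
    linkSheaf 𝓕 z = record
      { stalk      = λ x → stalk (value x)
      ; res        = λ x≺y → res (≺-value x≺y)
      ; res-linear = λ x≺y → res-linear (≺-value x≺y)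
      ; res-∘      = λ x≺y y≺u x≺u → res-∘ (≺-value x≺y) (≺-value y≺u) (≺-value x≺u)
      }
      where
      open Sheaf 𝓕
      ≺-value : ∀ {x y} → GradedPoset._≺_ (link X z) x y → value x ≺ value y
      ≺-value (x≼y , x≢y) = x≼y , λ eq → x≢y (value-injective eq)

  module _ {R : CommutativeRing r ℓr} (X : GradedPoset a ℓ)
           (inc : Incidence R X) (𝓕 : Sheaf R X m ℓm) where
    open GradedPoset X
    open Sheaf 𝓕
    private module 𝓕 x = Module (stalk x)

    Cochain : ℤ → Set (a ⊔ m)
    Cochain i = (x : [ x ∈ Face ∣ dim x ≡ i ]) → Section (value x)

    infix 4 _≈ᶜ_
    _≈ᶜ_ : ∀ {i} → Rel (Cochain i) (a ⊔ ℓm)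
    f ≈ᶜ g = ∀ x → 𝓕._≈ᴹ_ (value x) (f x) (g x)

    _-ᶜ_ : ∀ {i} → Cochain i → Cochain i → Cochain i
    (f -ᶜ g) x = 𝓕._+ᴹ_ (value x) (f x) (𝓕.-ᴹ_ (value x) (g x))

    0ᶜ : ∀ {i} → Cochain i
    0ᶜ x = 𝓕.0ᴹ (value x)

    δ : ∀ i → Cochain i → Cochain (ℤ.suc i)
    δ i f (y , [ dim-y ]) =
      sumOver (𝓕.+ᴹ-rawMonoid y) (enumerate {P = y ⟨ i ⟩} (λ x → lem) faces) λ where
        (x , [ x∈yi ]) → 𝓕._*ₗ_ y (inc y x)
          (res (≼⇒≺ (proj₁ x∈yi) dim-y (proj₂ x∈yi)) (f (x , [ proj₁ x∈yi ])))

    -- C^i viewed as the codomain of the coboundary map of degree i - 1.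
    δ⁻ : ∀ i → Cochain (ℤ.pred i) → Cochain i
    δ⁻ i g (x , [ dim-x ]) =
      δ (ℤ.pred i) g (x , [ trans dim-x (sym (ℤ.suc-pred i)) ])

    IsCocycle IsCoboundary : ∀ {i} → Cochain i → Set _
    IsCocycle {i} f    = δ i f ≈ᶜ 0ᶜ
    IsCoboundary {i} f = ∃[ g ] δ⁻ i g ≈ᶜ f

    supp : ∀ {i} → Cochain i → Pred Face ℓm
    supp {i} f x = Σ[ dim-x ∈ dim x ≡ i ] ¬ 𝓕._≈ᴹ_ x (f (x , [ dim-x ])) (𝓕.0ᴹ x)

    module _ (w : Face → Real) where

      ‖_‖ : ∀ {i} → Cochain i → Real
      ‖ f ‖ = weight X w (supp f)

      dist : ∀ {i} → Cochain i → Cochain i → Real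
      dist f g = ‖ f -ᶜ g ‖

      distToCoboundaries : ∀ {i} → Cochain i → Real
      distToCoboundaries {i} f =
        ⋀ (λ t → Σ[ g ∈ Cochain i ] IsCoboundary g × t ≈ dist f g)

      cbe : ℤ → Real ⁺
      cbe i = sup⁺ (λ μ → 0# ≤ μ ×
        (∀ (f : Cochain i) → μ * distToCoboundaries f ≤ ‖ δ i f ‖))

      ccd : ℤ → Real ⁺
      ccd i = inf⁺ (λ t → Σ[ f ∈ Cochain i ] IsCocycle f × ¬ IsCoboundary f × t ≈ ‖ f ‖)

{-# OPTIONS --safe #-}
-- Let f be a 0-cocycle that is not a coboundary and A its support.  For v ∈ A,
-- the value f v is a (-1)-cochain of the link of v at distance at least 1 from
-- the coboundaries, and every edge e ≽ v where its coboundary does not vanish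
-- has a second vertex in A, because the terms of (δ f) e add up to 0.  So (1)
-- says that in the link of v the set E₂ of edges with two vertices in A has
-- weight at least ε.  Summing over v ∈ A, comparing link weights with w, and
-- counting the pairs v ≼ e below a d-face in two ways gives
-- ε w(A) ≤ Λ⁴ w(E₂) for every Λ ≥ L(X), and (2) bounds w(E₂).  Hence
-- ε ≤ Λ⁴ (α + β w(A)); take Λ = L, or Λ = 1 in the lower-regular case.
module Submission where

open import Algebra.Bundles using (CommutativeMonoid; CommutativeRing)
open import Algebra.Module.Bundles using (Module)
open import Algebra.Module.Morphism.Structures using (module ModuleMorphisms)
import Algebra.Properties.CommutativeSemigroup as CommutativeSemigroupProperties
import Algebra.Properties.Group as GroupProperties
import Algebra.Properties.Ring as RingProperties
import Algebra.Solver.Ring.NaturalCoefficients.Default as SemiringSolver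
open import Axiom.ExcludedMiddle using (ExcludedMiddle)
open import Data.Bool.Base using (if_then_else_; true; false)
open import Data.Empty.Irrelevant using () renaming (⊥-elim to ⊥-elim-irr)
open import Data.Integer.Base as ℤ using (ℤ; +_; -1ℤ; 0ℤ; 1ℤ)
import Data.Integer.Properties as ℤ
open import Data.Irrelevant using ([_])
open import Data.List.Base using (List; []; _∷_; cartesianProduct; filter; length; map; upTo)
import Data.List.Extrema as Extrema
import Data.List.Extrema.Nat as ℕ-Extrema
open import Data.List.Membership.Propositional using (_∈_)
open import Data.List.Membership.Propositional.Properties
  using (∈-cartesianProduct⁺; ∈-filter⁺; ∈-filter⁻; ∈-length; ∈-map⁺; ∈-upTo⁺)
open import Data.List.Properties using (filter-some)
open import Data.List.Relation.Unary.All as All using ([]; _∷_)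
import Data.List.Relation.Unary.All.Properties as All
open import Data.List.Relation.Unary.AllPairs using ([]; _∷_)
open import Data.List.Relation.Unary.Any as Any using (here; there)
open import Data.List.Relation.Unary.Unique.Propositional using (Unique)
import Data.List.Relation.Unary.Unique.Propositional.Properties as Unique
open import Data.Nat.Base as ℕ using (ℕ; zero; suc; z≤n; s≤s)
import Data.Nat.Properties as ℕ
open import Data.Product.Base using (∃; ∃-syntax; ∃₂; _×_; _,_; proj₁; proj₂)
open import Data.Refinement using (Refinement; _,_; value; value-injective)
open import Data.Sum.Base using (inj₁; inj₂)
open import Function.Base using (_∘_)
open import Level using (Level; 0ℓ)
open import Relation.Binary.Bundles using (TotalOrder)
open import Relation.Binary.Construct.Add.Supremum.NonStrict using ([_]; _≤⊤⁺)
open import Relation.Binary.Construct.Closure.Transitive using (TransClosure; [_]; _∷_; _++_)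
open import Relation.Binary.PropositionalEquality as ≡ using (_≡_; _≢_; refl)
import Relation.Binary.Reasoning.PartialOrder as PosetReasoning
import Relation.Binary.Reasoning.Setoid as SetoidReasoning
open import Relation.Binary.Structures using (IsPartialOrder)
open import Relation.Nullary using (¬_; Dec; yes; no; does; contradiction)
open import Relation.Nullary.Construct.Add.Supremum using ([_])
open import Relation.Nullary.Decidable using (True; toWitness; fromWitness; recompute; decidable-stable)
open import Relation.Unary using (Pred; Decidable; Satisfiable)
open import Defs

private
  variable
    a c ℓ ℓ₁ ℓ₂ p q r ℓr m ℓm s t : Level
    A B : Set a

-- Finite sums in a commutative monoid and exchange of summation.

module Sums (M : CommutativeMonoid c ℓ) where
  open CommutativeMonoid M renaming (Carrier to C; refl to ≈-refl; sym to ≈-sym; trans to ≈-trans)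
  open SetoidReasoning setoid
  open CommutativeSemigroupProperties commutativeSemigroup using (interchange)

  sum : List A → (A → C) → C
  sum = sumOver rawMonoid

  sum-cong : ∀ (xs : List A) {f g : A → C} → (∀ {x} → x ∈ xs → f x ≈ g x) → sum xs f ≈ sum xs g
  sum-cong []       f≈g = ≈-refl
  sum-cong (_ ∷ xs) f≈g = ∙-cong (f≈g (here refl)) (sum-cong xs (f≈g ∘ there))

  sum-ε : ∀ (xs : List A) {f : A → C} → (∀ {x} → x ∈ xs → f x ≈ ε) → sum xs f ≈ ε
  sum-ε []       f≈ε = ≈-refl
  sum-ε (_ ∷ xs) f≈ε = ≈-trans (∙-cong (f≈ε (here refl)) (sum-ε xs (f≈ε ∘ there))) (identityˡ ε)

  sum-∙ : ∀ (xs : List A) (f g : A → C) → sum xs (λ x → f x ∙ g x) ≈ sum xs f ∙ sum xs g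
  sum-∙ []       f g = ≈-sym (identityˡ ε)
  sum-∙ (x ∷ xs) f g = ≈-trans (∙-congˡ (sum-∙ xs f g)) (interchange (f x) (g x) _ _)

  sum-single : ∀ {xs : List A} {x} {f : A → C} → Unique xs → x ∈ xs →
               (∀ {y} → y ≢ x → f y ≈ ε) → sum xs f ≈ f x
  sum-single {xs = _ ∷ xs} (x∉ ∷ _) (here refl) f≈ε =
    ≈-trans (∙-congˡ (sum-ε xs (λ y∈xs → f≈ε (All.lookup x∉ y∈xs ∘ ≡.sym)))) (identityʳ _)
  sum-single (y∉ ∷ uniq) (there x∈xs) f≈ε =
    ≈-trans (∙-cong (f≈ε (All.lookup y∉ x∈xs)) (sum-single uniq x∈xs f≈ε)) (identityˡ _)

  sum-swap : ∀ (xs : List A) (ys : List B) (f : A → B → C) →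
             sum xs (λ x → sum ys (f x)) ≈ sum ys (λ y → sum xs (λ x → f x y))
  sum-swap []       ys f = ≈-sym (sum-ε ys (λ _ → ≈-refl))
  sum-swap (x ∷ xs) ys f = ≈-trans (∙-congˡ (sum-swap xs ys f)) (≈-sym (sum-∙ ys (f x) _))

  sum-filter : ∀ {P : Pred A p} (P? : Decidable P) xs (f : A → C) →
               sum (filter P? xs) f ≈ sum xs (λ x → if does (P? x) then f x else ε)
  sum-filter P? []       f = ≈-refl
  sum-filter P? (x ∷ xs) f with P? x
  ... | yes _ = ∙-congˡ (sum-filter P? xs f)
  ... | no  _ = ≈-trans (sum-filter P? xs f) (≈-sym (identityˡ _))

  -- Moving both conditions into the summand leaves sums over two fixed lists, to which `sum-swap`
  -- applies.
  sum-filter-filter :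
    ∀ {P : Pred A p} {Q : A → Pred B q} (P? : Decidable P) (Q? : ∀ x → Decidable (Q x))
    xs ys (f : A → B → C) →
    sum (filter P? xs) (λ x → sum (filter (Q? x) ys) (f x)) ≈
    sum xs (λ x → sum ys (λ y → if does (P? x) then if does (Q? x y) then f x y else ε else ε))
  sum-filter-filter P? Q? xs ys f = ≈-trans (sum-filter P? xs _) (sum-cong xs (λ {x} _ → inner x))
    where
    inner : ∀ x → (if does (P? x) then sum (filter (Q? x) ys) (f x) else ε) ≈
      sum ys (λ y → if does (P? x) then if does (Q? x y) then f x y else ε else ε)
    inner x with does (P? x)
    ... | true  = sum-filter (Q? x) ys (f x)
    ... | false = ≈-sym (sum-ε ys (λ _ → ≈-refl))

  -- `to` and `from` say that both iterated sums run over the same set of pairs, so the summands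
  -- agree once they carry the conditions.
  sum-filter-swap :
    ∀ {P : Pred A p} {Q : A → Pred B q} {P′ : Pred B s} {Q′ : B → Pred A t}
    (P? : Decidable P) (Q? : ∀ x → Decidable (Q x))
    (P′? : Decidable P′) (Q′? : ∀ y → Decidable (Q′ y)) →
    (∀ {x y} → P x × Q x y → P′ y × Q′ y x) → (∀ {x y} → P′ y × Q′ y x → P x × Q x y) →
    ∀ xs ys (f : A → B → C) →
    sum (filter P? xs) (λ x → sum (filter (Q? x) ys) (f x)) ≈
    sum (filter P′? ys) (λ y → sum (filter (Q′? y) xs) (λ x → f x y))
  sum-filter-swap P? Q? P′? Q′? to from xs ys f = begin
    sum (filter P? xs) (λ x → sum (filter (Q? x) ys) (f x))
      ≈⟨ sum-filter-filter P? Q? xs ys f ⟩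
    sum xs (λ x → sum ys (λ y → if does (P? x) then if does (Q? x y) then f x y else ε else ε))
      ≈⟨ sum-swap xs ys _ ⟩
    sum ys (λ y → sum xs (λ x → if does (P? x) then if does (Q? x y) then f x y else ε else ε))
      ≈⟨ sum-cong ys (λ {y} _ → sum-cong xs (λ {x} _ → same x y)) ⟩
    sum ys (λ y → sum xs (λ x → if does (P′? y) then if does (Q′? y x) then f x y else ε else ε))
      ≈⟨ sum-filter-filter P′? Q′? ys xs (λ y x → f x y) ⟨
    sum (filter P′? ys) (λ y → sum (filter (Q′? y) xs) (λ x → f x y)) ∎
    where
    same : ∀ x y → (if does (P? x) then if does (Q? x y) then f x y else ε else ε) ≈
                   (if does (P′? y) then if does (Q′? y x) then f x y else ε else ε)
    same x y with P? x | Q? x y | P′? y | Q′? y x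
    ... | yes _  | yes _  | yes _  | yes _  = ≈-refl
    ... | yes px | yes qy | no ¬p  | _      = contradiction (proj₁ (to (px , qy))) ¬p
    ... | yes px | yes qy | yes _  | no ¬q  = contradiction (proj₂ (to (px , qy))) ¬q
    ... | yes _  | no ¬q  | yes p  | yes q  = contradiction (proj₂ (from (p , q))) ¬q
    ... | no ¬p  | _      | yes p  | yes q  = contradiction (proj₁ (from (p , q))) ¬p
    ... | yes _  | no _   | no _   | _      = ≈-refl
    ... | yes _  | no _   | yes _  | no _   = ≈-refl
    ... | no _   | _      | no _   | _      = ≈-refl
    ... | no _   | _      | yes _  | no _   = ≈-refl

-- Arithmetic and finite sums in an ordered field.

module OrderedField (ℝ : CompleteOrderedField c ℓ₁ ℓ₂) where
  open CompleteOrderedField ℝ hiding (refl; sym; trans)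
  open CompleteOrderedField ℝ using () renaming (refl to ≈-refl; sym to ≈-sym; trans to ≈-trans)
  open TotalOrder totalOrder public using (poset; ≤-respˡ-≈; ≤-respʳ-≈)
    renaming (total to ≤-total; refl to ≤-refl; trans to ≤-trans; antisym to ≤-antisym; reflexive to ≤-reflexive)
  module ≤-Reasoning = PosetReasoning poset
  open ≤-Reasoning
  open RingProperties ring using (-1*x≈-x; -‿involutive)
  open Sums +-commutativeMonoid public

  +-mono-≤ : ∀ {x y u v} → x ≤ y → u ≤ v → x + u ≤ y + v
  +-mono-≤ {x} {y} {u} {v} x≤y u≤v = begin
    x + u ≤⟨ +-monoˡ-≤ u x≤y ⟩
    y + u ≈⟨ +-comm y u ⟩
    u + y ≤⟨ +-monoˡ-≤ y u≤v ⟩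
    v + y ≈⟨ +-comm v y ⟩
    y + v ∎

  x≤y⇒0≤y-x : ∀ {x y} → x ≤ y → 0# ≤ y - x
  x≤y⇒0≤y-x {x} x≤y = ≤-respˡ-≈ (-‿inverseʳ x) (+-monoˡ-≤ (- x) x≤y)

  x≤y+z⇒x-z≤y : ∀ {x y z} → x ≤ y + z → x - z ≤ y
  x≤y+z⇒x-z≤y {x} {y} {z} x≤y+z = begin
    x - z       ≤⟨ +-monoˡ-≤ (- z) x≤y+z ⟩
    y + z - z   ≈⟨ +-assoc y z (- z) ⟩
    y + (z - z) ≈⟨ +-congˡ (-‿inverseʳ z) ⟩
    y + 0#      ≈⟨ +-identityʳ y ⟩
    y           ∎

  *-monoˡ-≤ : ∀ {k x y} → 0# ≤ k → x ≤ y → k * x ≤ k * y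
  *-monoˡ-≤ {k} {x} {y} 0≤k x≤y = begin
    k * x                 ≈⟨ +-identityˡ _ ⟨
    0# + k * x            ≤⟨ +-monoˡ-≤ (k * x) (*-nonNeg 0≤k (x≤y⇒0≤y-x x≤y)) ⟩
    k * (y - x) + k * x   ≈⟨ distribˡ k (y - x) x ⟨
    k * (y - x + x)       ≈⟨ *-congˡ (+-assoc y (- x) x) ⟩
    k * (y + (- x + x))   ≈⟨ *-congˡ (+-congˡ (-‿inverseˡ x)) ⟩
    k * (y + 0#)          ≈⟨ *-congˡ (+-identityʳ y) ⟩
    k * y                 ∎

  *-monoʳ-≤ : ∀ {k x y} → 0# ≤ k → x ≤ y → x * k ≤ y * k
  *-monoʳ-≤ {k} {x} {y} 0≤k x≤y =
    ≤-respˡ-≈ (*-comm k x) (≤-respʳ-≈ (*-comm k y) (*-monoˡ-≤ 0≤k x≤y))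

  *-mono-≤ : ∀ {x y u v} → 0# ≤ x → 0# ≤ v → x ≤ y → u ≤ v → x * u ≤ y * v
  *-mono-≤ 0≤x 0≤v x≤y u≤v = ≤-trans (*-monoˡ-≤ 0≤x u≤v) (*-monoʳ-≤ 0≤v x≤y)

  -- If 1 ≤ 0, then -1 is nonnegative, and so is its square, which is 1.
  0≤1 : 0# ≤ 1#
  0≤1 with ≤-total 0# 1#
  ... | inj₁ 0≤1 = 0≤1
  ... | inj₂ 1≤0 = begin
    0#          ≤⟨ *-nonNeg 0≤-1 0≤-1 ⟩
    - 1# * - 1# ≈⟨ -1*x≈-x (- 1#) ⟩
    - - 1#      ≈⟨ -‿involutive 1# ⟩
    1#          ∎
    where
    0≤-1 : 0# ≤ - 1#
    0≤-1 = ≤-respʳ-≈ (+-identityˡ _) (x≤y⇒0≤y-x 1≤0)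

  0<1 : 0# < 1#
  0<1 = 0≤1 , 0≉1

  ×ℕ1-nonNeg : ∀ n → 0# ≤ n ×ℕ 1#
  ×ℕ1-nonNeg zero    = ≤-refl
  ×ℕ1-nonNeg (suc n) = ≤-respˡ-≈ (+-identityˡ 0#) (+-mono-≤ 0≤1 (×ℕ1-nonNeg n))

  ×ℕ1-mono-≤ : ∀ {m n} → m ℕ.≤ n → m ×ℕ 1# ≤ n ×ℕ 1#
  ×ℕ1-mono-≤ {n = n} z≤n = ×ℕ1-nonNeg n
  ×ℕ1-mono-≤ (s≤s m≤n)   = +-mono-≤ ≤-refl (×ℕ1-mono-≤ m≤n)

  ^-nonNeg : ∀ {x} → 0# ≤ x → ∀ n → 0# ≤ x ^ n
  ^-nonNeg 0≤x zero    = 0≤1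
  ^-nonNeg 0≤x (suc n) = *-nonNeg 0≤x (^-nonNeg 0≤x n)

  <-≤-trans : ∀ {x y z} → x < y → y ≤ z → x < z
  <-≤-trans x<y y≤z = begin-strict _ <⟨ x<y ⟩ _ ≤⟨ y≤z ⟩ _ ∎

  ×ℕ1-pos : ∀ {n} → 1 ℕ.≤ n → 0# < n ×ℕ 1#
  ×ℕ1-pos 1≤n = <-≤-trans 0<1 (≤-respˡ-≈ (+-identityʳ 1#) (×ℕ1-mono-≤ 1≤n))

  sum-mono-≤ : ∀ (xs : List A) {f g : A → Carrier} → (∀ {x} → x ∈ xs → f x ≤ g x) → sum xs f ≤ sum xs g
  sum-mono-≤ []       f≤g = ≤-refl
  sum-mono-≤ (_ ∷ xs) f≤g = +-mono-≤ (f≤g (here refl)) (sum-mono-≤ xs (f≤g ∘ there))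

  sum-nonNeg : ∀ (xs : List A) {f : A → Carrier} → (∀ {x} → x ∈ xs → 0# ≤ f x) → 0# ≤ sum xs f
  sum-nonNeg xs 0≤f = ≤-respˡ-≈ (sum-ε xs (λ _ → ≈-refl)) (sum-mono-≤ xs 0≤f)

  term≤sum : ∀ {xs : List A} {x} {f : A → Carrier} → (∀ y → 0# ≤ f y) → x ∈ xs → f x ≤ sum xs f
  term≤sum {xs = y ∷ xs} 0≤f (here refl)  =
    ≤-respˡ-≈ (+-identityʳ _) (+-mono-≤ ≤-refl (sum-nonNeg xs (λ {y} _ → 0≤f y)))
  term≤sum {xs = y ∷ _}  0≤f (there x∈xs) =
    ≤-respˡ-≈ (+-identityˡ _) (+-mono-≤ (0≤f y) (term≤sum 0≤f x∈xs))

  *-distribˡ-sum : ∀ k (xs : List A) (f : A → Carrier) → k * sum xs f ≈ sum xs (λ x → k * f x)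
  *-distribˡ-sum k []       f = zeroʳ k
  *-distribˡ-sum k (x ∷ xs) f = ≈-trans (distribˡ k _ _) (+-congˡ (*-distribˡ-sum k xs f))

  length≈sum : ∀ (xs : List A) → length xs ×ℕ 1# ≈ sum xs (λ _ → 1#)
  length≈sum []       = ≈-refl
  length≈sum (_ ∷ xs) = +-congˡ (length≈sum xs)

  sum-const : ∀ k (xs : List A) → sum xs (λ _ → k) ≈ (length xs ×ℕ 1#) * k
  sum-const k []       = ≈-sym (zeroˡ k)
  sum-const k (_ ∷ xs) = begin-equality
    k + sum xs (λ _ → k)             ≈⟨ +-cong (≈-sym (*-identityˡ k)) (sum-const k xs) ⟩
    1# * k + (length xs ×ℕ 1#) * k   ≈⟨ distribʳ k 1# _ ⟨
    (1# + length xs ×ℕ 1#) * k       ∎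

  sum-filter-mono :
    ∀ {P : Pred A p} {Q : Pred A q} (P? : Decidable P) (Q? : Decidable Q) → (∀ {x} → P x → Q x) →
    ∀ xs {f : A → Carrier} → (∀ x → 0# ≤ f x) → sum (filter P? xs) f ≤ sum (filter Q? xs) f
  sum-filter-mono P? Q? P⊆Q []       0≤f = ≤-refl
  sum-filter-mono P? Q? P⊆Q (x ∷ xs) 0≤f with P? x | Q? x
  ... | yes _  | yes _ = +-mono-≤ ≤-refl (sum-filter-mono P? Q? P⊆Q xs 0≤f)
  ... | yes px | no ¬q = contradiction (P⊆Q px) ¬q
  ... | no _   | yes _ = ≤-respˡ-≈ (+-identityˡ _) (+-mono-≤ (0≤f x) (sum-filter-mono P? Q? P⊆Q xs 0≤f))
  ... | no _   | no _  = sum-filter-mono P? Q? P⊆Q xs 0≤f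

  -- Serves to compare a norm in a link, whose faces are refined faces of `X`, with a sum over `X`
  -- itself: further elements satisfying `S` only add nonnegative terms.
  sum-filter-enumerate :
    ∀ {P : Pred A p} {Q : Pred (Refinement A P) q} {S : Pred A s}
    (P? : Decidable P) (Q? : Decidable Q) (S? : Decidable S) →
    (∀ {x} → Q x → S (value x)) → ∀ xs (f : A → Carrier) → (∀ x → 0# ≤ f x) →
    sum (filter Q? (enumerate P? xs)) (λ x → f (value x)) ≤ sum (filter S? xs) f
  sum-filter-enumerate P? Q? S? Q⊆S []       f 0≤f = ≤-refl
  sum-filter-enumerate P? Q? S? Q⊆S (x ∷ xs) f 0≤f with P? x
  ... | yes px with Q? (x , [ px ]) | S? x
  ...   | yes _ | yes _ = +-mono-≤ ≤-refl (sum-filter-enumerate P? Q? S? Q⊆S xs f 0≤f)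
  ...   | yes q | no ¬s = contradiction (Q⊆S q) ¬s
  ...   | no _  | yes _ = ≤-respˡ-≈ (+-identityˡ _) (+-mono-≤ (0≤f x) (sum-filter-enumerate P? Q? S? Q⊆S xs f 0≤f))
  ...   | no _  | no _  = sum-filter-enumerate P? Q? S? Q⊆S xs f 0≤f
  sum-filter-enumerate P? Q? S? Q⊆S (x ∷ xs) f 0≤f | no _ with S? x
  ...   | yes _ = ≤-respˡ-≈ (+-identityˡ _) (+-mono-≤ (0≤f x) (sum-filter-enumerate P? Q? S? Q⊆S xs f 0≤f))
  ...   | no _  = sum-filter-enumerate P? Q? S? Q⊆S xs f 0≤f

-- Lengths of filtered and duplicate-free lists.

length-filter-mono : ∀ {P : Pred A p} {Q : Pred A q} (P? : Decidable P) (Q? : Decidable Q) →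
                     (∀ {x} → P x → Q x) → ∀ xs → length (filter P? xs) ℕ.≤ length (filter Q? xs)
length-filter-mono P? Q? P⊆Q []       = z≤n
length-filter-mono P? Q? P⊆Q (x ∷ xs) with P? x | Q? x
... | yes _  | yes _ = s≤s (length-filter-mono P? Q? P⊆Q xs)
... | yes px | no ¬q = contradiction (P⊆Q px) ¬q
... | no _   | yes _ = ℕ.m≤n⇒m≤1+n (length-filter-mono P? Q? P⊆Q xs)
... | no _   | no _  = length-filter-mono P? Q? P⊆Q xs

length≤1 : ∀ {xs : List A} {x} → Unique xs → (∀ {y} → y ∈ xs → y ≡ x) → length xs ℕ.≤ 1
length≤1 {xs = []}        _                  _   = z≤n
length≤1 {xs = _ ∷ []}    _                  _   = s≤s z≤n
length≤1 {xs = _ ∷ _ ∷ _} ((x≢y ∷ _) ∷ _) all = contradiction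
  (≡.trans (all (here refl)) (≡.sym (all (there (here refl))))) x≢y

-- Saturated chains in a finite graded poset.

module Intervals (lem : ∀ {p} → ExcludedMiddle p) (X : GradedPoset a ℓ) where
  open GradedPoset X
  private module ≼ = IsPartialOrder isPartialOrder

  ≺-trans : ∀ {x y z} → x ≺ y → y ≺ z → x ≺ z
  ≺-trans (x≼y , x≢y) (y≼z , _) = ≼.trans x≼y y≼z , λ { refl → x≢y (≼.antisym x≼y y≼z) }

  -- Induction on a list containing the open interval (x, z): its head, when
  -- in the interval, splits it into two intervals not containing it.
  ≺⇒⋖⁺-within : ∀ ys {x z} → (∀ y → x ≺ y → y ≺ z → y ∈ ys) → x ≺ z → TransClosure _⋖_ x z
  ≺⇒⋖⁺-within []       ⊆ys x≺z = [ x≺z , (λ y (x≺y , y≺z) → contradiction (⊆ys y x≺y y≺z) λ ()) ]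
  ≺⇒⋖⁺-within (u ∷ us) {x} {z} ⊆ys x≺z with lem {P = x ≺ u × u ≺ z}
  ... | yes (x≺u , u≺z) =
    ≺⇒⋖⁺-within us (λ y x≺y y≺u → Any.tail (proj₂ y≺u) (⊆ys y x≺y (≺-trans y≺u u≺z))) x≺u ++
    ≺⇒⋖⁺-within us (λ y u≺y y≺z → Any.tail (proj₂ u≺y ∘ ≡.sym) (⊆ys y (≺-trans x≺u u≺y) y≺z)) u≺z
  ... | no ¬between =
    ≺⇒⋖⁺-within us (λ y x≺y y≺z → Any.tail (λ { refl → ¬between (x≺y , y≺z) }) (⊆ys y x≺y y≺z)) x≺z

  ≺⇒⋖⁺ : ∀ {x z} → x ≺ z → TransClosure _⋖_ x z
  ≺⇒⋖⁺ = ≺⇒⋖⁺-within faces (λ y _ _ → faces-complete y)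

  ⋖⁺⇒≼ : ∀ {x z} → TransClosure _⋖_ x z → x ≼ z
  ⋖⁺⇒≼ [ x⋖z ]       = proj₁ (proj₁ x⋖z)
  ⋖⁺⇒≼ (x⋖y ∷ y⋖⁺z) = ≼.trans (proj₁ (proj₁ x⋖y)) (⋖⁺⇒≼ y⋖⁺z)

  dim-⋖⁺ : ∀ {x z} → TransClosure _⋖_ x z → dim x ℤ.< dim z
  dim-⋖⁺ [ x⋖z ] = ℤ.suc[i]≤j⇒i<j (ℤ.≤-reflexive (≡.sym (dim-⋖ x⋖z)))
  dim-⋖⁺ (x⋖y ∷ y⋖⁺z) = ℤ.<-trans (dim-⋖⁺ [ x⋖y ]) (dim-⋖⁺ y⋖⁺z)

  -- If `z` differed from `x`, a chain of covers from `x` to `z` would raise the dimension at every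
  -- step.
  ≼-dim-injective : ∀ {x z} → x ≼ z → dim z ≡ dim x → z ≡ x
  ≼-dim-injective {x} {z} x≼z dim≡ with lem {P = z ≡ x}
  ... | yes z≡x = z≡x
  ... | no  z≢x = contradiction (≡.sym dim≡) (ℤ.<⇒≢ (dim-⋖⁺ (≺⇒⋖⁺ (x≼z , z≢x ∘ ≡.sym))))

  -- Each cover raises the dimension by exactly one, so a chain of covers cannot jump over `j`.
  ⋖⁺-intermediate : ∀ {x z j} → TransClosure _⋖_ x z → dim x ℤ.≤ j → j ℤ.≤ dim z →
                    ∃[ y ] dim y ≡ j × x ≼ y × y ≼ z
  ⋖⁺-intermediate {x} {z} {j} x⋖⁺z i≤j j≤k with dim x ℤ.≟ j
  ... | yes i≡j = x , i≡j , ≼.refl , ⋖⁺⇒≼ x⋖⁺z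
  ... | no  i≢j with x⋖⁺z
  -- Here `dim x < j ≤ dim z = dim x + 1`, so `z` itself has dimension `j`.
  ...   | [ x⋖z ] = z , ℤ.≤-antisym (ℤ.≤-trans (ℤ.≤-reflexive (dim-⋖ x⋖z)) (ℤ.i<j⇒suc[i]≤j (ℤ.≤∧≢⇒< i≤j i≢j))) j≤k
                  , proj₁ (proj₁ x⋖z) , ≼.refl
  ...   | x⋖y ∷ y⋖⁺z
        with y′ , dim≡ , y≼y′ , y′≼z ← ⋖⁺-intermediate y⋖⁺z
               (ℤ.≤-trans (ℤ.≤-reflexive (dim-⋖ x⋖y)) (ℤ.i<j⇒suc[i]≤j (ℤ.≤∧≢⇒< i≤j i≢j))) j≤k
        = y′ , dim≡ , ≼.trans (proj₁ (proj₁ x⋖y)) y≼y′ , y′≼z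

  intermediate : ∀ {x z j} → x ≼ z → dim x ℤ.≤ j → j ℤ.≤ dim z →
                 ∃[ y ] dim y ≡ j × x ≼ y × y ≼ z
  intermediate {x} {z} x≼z i≤j j≤k with lem {P = x ≡ z}
  ... | yes refl = x , ℤ.≤-antisym i≤j j≤k , ≼.refl , ≼.refl
  ... | no  x≢z  = ⋖⁺-intermediate (≺⇒⋖⁺ (x≼z , x≢z)) i≤j j≤k

-- Division, suprema and infima in the complete ordered field.

module ExpansionProperties (lem : ∀ {p} → ExcludedMiddle p) (ℝ : CompleteOrderedField c ℓ₁ ℓ₂) where
  open CompleteOrderedField ℝ hiding (refl; sym; trans)
  open CompleteOrderedField ℝ using () renaming (refl to ≈-refl; sym to ≈-sym; trans to ≈-trans)
  open OrderedField ℝ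
  open Expansion lem ℝ using
    (_⁻¹; _/_; fromℕ; ⋁; ⋀; sup⁺; inf⁺; _≤⁺_; ∣_∣; chainCounts; Fmax; Fmin; lowerIrregularity)
  open ≤-Reasoning
  open CommutativeSemigroupProperties *-commutativeSemigroup using (x∙yz≈y∙xz)

  ⁻¹-inverseˡ : ∀ {x} → x ≉ 0# → x ⁻¹ * x ≈ 1#
  ⁻¹-inverseˡ {x} x≉0 with lem {P = x ≉ 0#}
  ... | yes x≉0′ = proj₁ (proj₂ (invertible x≉0′))
  ... | no  ¬x≉0 = contradiction x≉0 ¬x≉0

  ⁻¹-inverseʳ : ∀ {x} → x ≉ 0# → x * x ⁻¹ ≈ 1#
  ⁻¹-inverseʳ {x} x≉0 = ≈-trans (*-comm x (x ⁻¹)) (⁻¹-inverseˡ x≉0)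

  0<x⇒x≉0 : ∀ {x} → 0# < x → x ≉ 0#
  0<x⇒x≉0 (_ , 0≉x) = 0≉x ∘ ≈-sym

  -- An inverse `y ≤ 0` of `x ≥ 0` would give `1 = y * x ≤ 0`; the default value 0 is nonnegative as
  -- well.
  ⁻¹-nonNeg : ∀ {x} → 0# ≤ x → 0# ≤ x ⁻¹
  ⁻¹-nonNeg {x} 0≤x with lem {P = x ≉ 0#}
  ... | no  _   = ≤-refl
  ... | yes x≉0 with y , yx≈1 , _ ← invertible x≉0 with ≤-total 0# y
  ...   | inj₁ 0≤y = 0≤y
  ...   | inj₂ y≤0 = contradiction (≤-antisym 0≤1 (begin
      1#     ≈⟨ yx≈1 ⟨
      y * x  ≤⟨ *-monoʳ-≤ 0≤x y≤0 ⟩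
      0# * x ≈⟨ zeroˡ x ⟩
      0#     ∎)) 0≉1

  ⁻¹-pos : ∀ {x} → 0# < x → 0# < x ⁻¹
  ⁻¹-pos {x} 0<x = ⁻¹-nonNeg (proj₁ 0<x) , λ 0≈x⁻¹ → 0≉1 (begin-equality
    0#        ≈⟨ zeroˡ x ⟨
    0# * x    ≈⟨ *-congʳ 0≈x⁻¹ ⟩
    x ⁻¹ * x  ≈⟨ ⁻¹-inverseˡ (0<x⇒x≉0 0<x) ⟩
    1#        ∎)

  /-nonNeg : ∀ {x y} → 0# ≤ x → 0# ≤ y → 0# ≤ x / y
  /-nonNeg 0≤x 0≤y = *-nonNeg 0≤x (⁻¹-nonNeg 0≤y)

  *-cancelˡ-≤ : ∀ {k x y} → 0# < k → k * x ≤ k * y → x ≤ y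
  *-cancelˡ-≤ {k} {x} {y} 0<k kx≤ky = begin
    x              ≈⟨ cancel x ⟨
    k ⁻¹ * (k * x) ≤⟨ *-monoˡ-≤ (⁻¹-nonNeg (proj₁ 0<k)) kx≤ky ⟩
    k ⁻¹ * (k * y) ≈⟨ cancel y ⟩
    y              ∎
    where
    cancel : ∀ z → k ⁻¹ * (k * z) ≈ z
    cancel z = ≈-trans (≈-sym (*-assoc _ k z))
      (≈-trans (*-congʳ (⁻¹-inverseˡ (0<x⇒x≉0 0<k))) (*-identityˡ z))

  *-pos : ∀ {x y} → 0# < x → 0# < y → 0# < x * y
  *-pos {x} {y} 0<x 0<y = *-nonNeg (proj₁ 0<x) (proj₁ 0<y) , λ 0≈xy → proj₂ 0<y (≤-antisym (proj₁ 0<y)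
    (*-cancelˡ-≤ 0<x (≤-reflexive (≈-trans (≈-sym 0≈xy) (≈-sym (zeroʳ x))))))

  *-cancel-/ : ∀ {x y} → 0# < y → y * (x / y) ≈ x
  *-cancel-/ {x} {y} 0<y = begin-equality
    y * (x * y ⁻¹) ≈⟨ x∙yz≈y∙xz y x _ ⟩
    x * (y * y ⁻¹) ≈⟨ *-congˡ (⁻¹-inverseʳ (0<x⇒x≉0 0<y)) ⟩
    x * 1#         ≈⟨ *-identityʳ x ⟩
    x              ∎

  ≤*⇒/≤ : ∀ {x y z} → 0# < y → x ≤ y * z → x / y ≤ z
  ≤*⇒/≤ 0<y x≤yz = *-cancelˡ-≤ 0<y (≤-trans (≤-reflexive (*-cancel-/ 0<y)) x≤yz)

  /≤⇒≤* : ∀ {x y z} → 0# < y → x / y ≤ z → x ≤ y * z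
  /≤⇒≤* 0<y x/y≤z = ≤-trans (≤-reflexive (≈-sym (*-cancel-/ 0<y))) (*-monoˡ-≤ (proj₁ 0<y) x/y≤z)

  -- Together with `≤-*-/`, this trades the varying denominators in a weight for one count: `k` is a
  -- lower bound of the denominators here and an upper bound there.
  *-/-≤ : ∀ {k x y} → 0# ≤ x → 0# < y → k ≤ y → k * (x / y) ≤ x
  *-/-≤ 0≤x 0<y k≤y =
    ≤-trans (*-monoʳ-≤ (/-nonNeg 0≤x (proj₁ 0<y)) k≤y) (≤-reflexive (*-cancel-/ 0<y))

  ≤-*-/ : ∀ {k x y} → 0# ≤ x → 0# < y → y ≤ k → x ≤ k * (x / y)
  ≤-*-/ 0≤x 0<y y≤k =
    ≤-trans (≤-reflexive (≈-sym (*-cancel-/ 0<y))) (*-monoʳ-≤ (/-nonNeg 0≤x (proj₁ 0<y)) y≤k)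

  ⋁-least : ∀ {S : Pred Carrier p} {u} → IsUpperBound S u → 0# ≤ u → ⋁ S ≤ u
  ⋁-least {S = S} bound 0≤u with lem {P = Satisfiable S × BoundedAbove S}
  ... | yes (nonempty , bounded) = proj₂ (proj₂ (complete S nonempty bounded)) _ bound
  ... | no  _                    = 0≤u

  ≤-⋁ : ∀ {S : Pred Carrier p} {x} → BoundedAbove S → S x → x ≤ ⋁ S
  ≤-⋁ {S = S} bounded x∈S with lem {P = Satisfiable S × BoundedAbove S}
  ... | yes (nonempty , bounded) = proj₁ (proj₂ (complete S nonempty bounded)) _ x∈S
  ... | no  ¬nb                  = contradiction ((_ , x∈S) , bounded) ¬nb

  -- `⋀ S` is the supremum of the lower bounds of `S`. A member of `S` bounds these from above, so
  -- this supremum is not the default value.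
  ≤-⋀ : ∀ {S : Pred Carrier p} {l} → Satisfiable S → (∀ x → S x → l ≤ x) → l ≤ ⋀ S
  ≤-⋀ (x , x∈S) lower = ≤-⋁ (x , λ l l-lower → l-lower x x∈S) lower

  -- An upper bound of `S` rules out the value ∞ of `sup⁺ S`, so a lower bound on an expansion
  -- constant becomes an inequality between reals.
  ≤-sup⁺⇒≤ : ∀ {S : Pred Carrier p} {x u} → IsUpperBound S u → 0# ≤ u → [ x ] ≤⁺ sup⁺ S → x ≤ u
  ≤-sup⁺⇒≤ {S = S} bound 0≤u x≤sup with lem {P = BoundedAbove S} | x≤sup
  ... | yes _   | [ x≤⋁ ] = ≤-trans x≤⋁ (⋁-least bound 0≤u)
  ... | no  ¬bd | _       = contradiction (_ , bound) ¬bd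

  ≤-inf⁺ : ∀ {S : Pred Carrier p} {l} → (∀ x → S x → l ≤ x) → [ l ] ≤⁺ inf⁺ S
  ≤-inf⁺ {S = S} lower with lem {P = Satisfiable S}
  ... | yes nonempty = [ ≤-⋀ nonempty lower ]
  ... | no  _        = _ ≤⊤⁺

  -- Interval counts and lower irregularity.

  module Counts {d} (X : GradedPoset a ℓ) (X-d : IsDPoset d X) where
    open GradedPoset X
    open IsDPoset X-d
    open Intervals lem X
    private module ≼ = IsPartialOrder isPartialOrder

    ∣∣-mono : {P : Pred Face p} {Q : Pred Face q} → (∀ {x} → P x → Q x) →
              ∣_∣ X P ℕ.≤ ∣_∣ X Q
    ∣∣-mono P⊆Q = length-filter-mono (λ _ → lem) (λ _ → lem) P⊆Q faces

    ∣∣-pos : {P : Pred Face p} {x : Face} → P x → 1 ℕ.≤ ∣_∣ X P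
    ∣∣-pos {x = x} px = filter-some (λ _ → lem) (Any.map (λ { refl → px }) (faces-complete x))

    ∣∣≤1 : {P : Pred Face p} {x : Face} → (∀ {y} → P y → y ≡ x) → ∣_∣ X P ℕ.≤ 1
    ∣∣≤1 only = length≤1 (Unique.filter⁺ (λ _ → lem) faces-unique)
      (λ y∈ → only (proj₂ (∈-filter⁻ (λ _ → lem) {xs = faces} y∈)))

    -- The predicate counted by `chainCounts` and by the denominators of `linkWeight`, in the same
    -- form, so that these counts agree by definition.
    chain : ℤ → Face → Face → Pred Face ℓ
    chain j x z y = dim y ≡ j × x ≼ y × y ≼ z

    chain-count∈ : ∀ {i j k x z} → dim x ≡ i → dim z ≡ k → x ≼ z →
                   ∣_∣ X (chain j x z) ∈ chainCounts X i j k
    chain-count∈ {x = x} {z} dim-x dim-z x≼z = ∈-map⁺ _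
      (∈-filter⁺ (λ _ → lem) (∈-cartesianProduct⁺ (faces-complete x) (faces-complete z))
        (dim-x , dim-z , x≼z))

    Fmin≤ : ∀ {i j k x z} → dim x ≡ i → dim z ≡ k → x ≼ z →
            Fmin X i j k ℕ.≤ ∣_∣ X (chain j x z)
    Fmin≤ {i} {j} {k} dim-x dim-z x≼z =
      All.lookup (ℕ-Extrema.min≤xs (length faces) (chainCounts X i j k)) (chain-count∈ dim-x dim-z x≼z)

    ≤Fmax : ∀ {i j k x z} → dim x ≡ i → dim z ≡ k → x ≼ z →
            ∣_∣ X (chain j x z) ℕ.≤ Fmax X i j k
    ≤Fmax {i} {j} {k} dim-x dim-z x≼z =
      All.lookup (ℕ-Extrema.xs≤max 0 (chainCounts X i j k)) (chain-count∈ dim-x dim-z x≼z)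

    -- Every interval counted contains a face of dimension `j` by `intermediate`, and the base value
    -- `length faces` of the minimum is positive because of `∅`.
    Fmin-pos : ∀ {i j k} → i ℤ.≤ j → j ℤ.≤ k → 1 ℕ.≤ Fmin X i j k
    Fmin-pos {i} {j} {k} i≤j j≤k = ℕ-Extrema.v≤min⁺ (∈-length (faces-complete ∅))
      (All.map⁺ {xs = filter (λ (x , z) → lem {P = dim x ≡ i × dim z ≡ k × x ≼ z}) (cartesianProduct faces faces)}
        (All.map (positive _ _) (All.all-filter (λ _ → lem) (cartesianProduct faces faces))))
      where
      positive : ∀ x z → dim x ≡ i × dim z ≡ k × x ≼ z → 1 ℕ.≤ ∣_∣ X (chain j x z)
      positive x z (refl , refl , x≼z) = ∣∣-pos (proj₂ (intermediate x≼z i≤j j≤k))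

    -- Indices are shifted by one as in the definition of `lowerIrregularity`: the natural number
    -- `i` stands for the dimension `i - 1`, and `1 + d` for `d`.
    Fmax/Fmin≤ : ∀ {i j k} → i ℕ.≤ j → j ℕ.≤ k → k ℕ.≤ 1 ℕ.+ d →
      fromℕ (Fmax X (ℤ.pred (+ i)) (ℤ.pred (+ j)) (ℤ.pred (+ k))) /
      fromℕ (Fmin X (ℤ.pred (+ i)) (ℤ.pred (+ j)) (ℤ.pred (+ k))) ≤ lowerIrregularity X d
    Fmax/Fmin≤ i≤j j≤k k≤1+d =
      All.lookup (Extrema.xs≤max totalOrder 0# _) (∈-map⁺ _ (∈-filter⁺ (λ _ → lem)
        (∈-cartesianProduct⁺ (dims∈ (ℕ.≤-trans i≤j (ℕ.≤-trans j≤k k≤1+d)))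
          (∈-cartesianProduct⁺ (dims∈ (ℕ.≤-trans j≤k k≤1+d)) (dims∈ k≤1+d)))
        (pred-mono i≤j , pred-mono j≤k)))
      where
      dims∈ : ∀ {n} → n ℕ.≤ 1 ℕ.+ d → ℤ.pred (+ n) ∈ map (λ n → ℤ.pred (+ n)) (upTo (2 ℕ.+ d))
      dims∈ n≤1+d = ∈-map⁺ _ (∈-upTo⁺ (s≤s n≤1+d))
      pred-mono : ∀ {m n} → m ℕ.≤ n → ℤ.pred (+ m) ℤ.≤ ℤ.pred (+ n)
      pred-mono m≤n = ℤ.pred-mono (ℤ.+≤+ m≤n)

    Fmax≤Λ*Fmin : ∀ {i j k Λ} → i ℕ.≤ j → j ℕ.≤ k → k ℕ.≤ 1 ℕ.+ d → lowerIrregularity X d ≤ Λ →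
      fromℕ (Fmax X (ℤ.pred (+ i)) (ℤ.pred (+ j)) (ℤ.pred (+ k))) ≤
      fromℕ (Fmin X (ℤ.pred (+ i)) (ℤ.pred (+ j)) (ℤ.pred (+ k))) * Λ
    Fmax≤Λ*Fmin i≤j j≤k k≤1+d irr≤Λ =
      /≤⇒≤* (×ℕ1-pos (Fmin-pos (ℤ.pred-mono (ℤ.+≤+ i≤j)) (ℤ.pred-mono (ℤ.+≤+ j≤k))))
            (≤-trans (Fmax/Fmin≤ i≤j j≤k k≤1+d) irr≤Λ)

-- Comparison of the weights of links with the weight of the poset.

module Weighted (lem : ∀ {p} → ExcludedMiddle p) (ℝ : CompleteOrderedField c ℓ₁ ℓ₂)
  {d} (1≤d : 1 ℕ.≤ d) (X : GradedPoset a ℓ) (X-d : IsDPoset d X) where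
  open CompleteOrderedField ℝ hiding (refl; sym; trans)
  open CompleteOrderedField ℝ using () renaming (refl to ≈-refl; sym to ≈-sym; trans to ≈-trans)
  open OrderedField ℝ
  open ExpansionProperties lem ℝ
  open Expansion lem ℝ hiding (_≈_; _≤_; _<_; _+_; _*_; _-_; _^_; 0#; 1#)
  open Counts X X-d
  open Intervals lem X
  open GradedPoset X
  open IsDPoset X-d
  open ≤-Reasoning
  open SemiringSolver commutativeSemiring using (solve; _:=_; _:*_; _:^_)
  private module ≼ = IsPartialOrder isPartialOrder

  ∑-swap : {P : Pred Face p} {Q : Face → Pred Face q} {P′ : Pred Face s} {Q′ : Face → Pred Face t} →
    (∀ {x y} → P x × Q x y → P′ y × Q′ y x) → (∀ {x y} → P′ y × Q′ y x → P x × Q x y) →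
    ∀ (f : Face → Face → Carrier) →
    ∑ X P (λ x → ∑ X (Q x) (f x)) ≈ ∑ X P′ (λ y → ∑ X (Q′ y) (λ x → f x y))
  ∑-swap to from f = sum-filter-swap (λ _ → lem) (λ _ _ → lem) (λ _ → lem) (λ _ _ → lem) to from faces faces f

  ∑-mono-≤ : {P : Pred Face p} {f g : Face → Carrier} → (∀ {x} → P x → f x ≤ g x) → ∑ X P f ≤ ∑ X P g
  ∑-mono-≤ {P = P} f≤g = sum-mono-≤ (select X P)
    (λ x∈ → f≤g (proj₂ (∈-filter⁻ (λ _ → lem) {xs = faces} x∈)))

  ∈-select : {P : Pred Face p} {x : Face} → P x → x ∈ select X P
  ∈-select {x = x} px = ∈-filter⁺ (λ _ → lem) (faces-complete x) px

  -- The least numbers of vertices of a `d`-face and of edges between a vertex and a `d`-face; the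
  -- greatest numbers of edges of a `d`-face and of vertices of an edge. Comparing weights first
  -- yields the constant `P₀ * Q₀ / (p₀ * q₀)`.
  p₀ q₀ P₀ Q₀ : Carrier
  p₀ = fromℕ (Fmin X -1ℤ 0ℤ (+ d))
  q₀ = fromℕ (Fmin X 0ℤ 1ℤ (+ d))
  P₀ = fromℕ (Fmax X -1ℤ 1ℤ (+ d))
  Q₀ = fromℕ (Fmax X -1ℤ 0ℤ 1ℤ)

  -- Pairs v ≼ e of faces of dimensions 0 and 1 below a fixed d-face, counted
  -- edge by edge and vertex by vertex.
  double-counting :
    fromℕ (Fmin X -1ℤ 1ℤ (+ d)) * fromℕ (Fmin X -1ℤ 0ℤ 1ℤ) ≤
    fromℕ (Fmax X -1ℤ 0ℤ (+ d)) * fromℕ (Fmax X 0ℤ 1ℤ (+ d))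
  double-counting with y , dim-y , ∅≼y ← pure ∅ = begin
    fromℕ (Fmin X -1ℤ 1ℤ (+ d)) * fromℕ (Fmin X -1ℤ 0ℤ 1ℤ)
      ≤⟨ *-monoʳ-≤ (×ℕ1-nonNeg (Fmin X -1ℤ 0ℤ 1ℤ)) (×ℕ1-mono-≤ (Fmin≤ dim-∅ dim-y ∅≼y)) ⟩
    fromℕ (∣_∣ X (chain 1ℤ ∅ y)) * fromℕ (Fmin X -1ℤ 0ℤ 1ℤ)
      ≈⟨ sum-const _ (select X (chain 1ℤ ∅ y)) ⟨
    ∑ X (chain 1ℤ ∅ y) (λ _ → fromℕ (Fmin X -1ℤ 0ℤ 1ℤ))
      ≤⟨ ∑-mono-≤ (λ {e} (dim-e , ∅≼e , _) → ≤-trans (×ℕ1-mono-≤ (Fmin≤ dim-∅ dim-e ∅≼e))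
           (≤-reflexive (length≈sum (select X (chain 0ℤ ∅ e))))) ⟩
    ∑ X (chain 1ℤ ∅ y) (λ e → ∑ X (chain 0ℤ ∅ e) (λ _ → 1#))
      ≈⟨ ∑-swap
           (λ ((dim-e , _ , e≼y) , (dim-v , ∅≼v , v≼e)) → (dim-v , ∅≼v , ≼.trans v≼e e≼y) , (dim-e , v≼e , e≼y))
           (λ ((dim-v , ∅≼v , _) , (dim-e , v≼e , e≼y)) → (dim-e , ∅-least _ , e≼y) , (dim-v , ∅≼v , v≼e))
           (λ _ _ → 1#) ⟩
    ∑ X (chain 0ℤ ∅ y) (λ v → ∑ X (chain 1ℤ v y) (λ _ → 1#))
      ≤⟨ ∑-mono-≤ (λ {v} (dim-v , _ , v≼y) → ≤-trans
           (≤-reflexive (≈-sym (length≈sum (select X (chain 1ℤ v y))))) (×ℕ1-mono-≤ (≤Fmax dim-v dim-y v≼y))) ⟩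
    ∑ X (chain 0ℤ ∅ y) (λ _ → fromℕ (Fmax X 0ℤ 1ℤ (+ d)))
      ≈⟨ sum-const _ (select X (chain 0ℤ ∅ y)) ⟩
    fromℕ (∣_∣ X (chain 0ℤ ∅ y)) * fromℕ (Fmax X 0ℤ 1ℤ (+ d))
      ≤⟨ *-monoʳ-≤ (×ℕ1-nonNeg (Fmax X 0ℤ 1ℤ (+ d))) (×ℕ1-mono-≤ (≤Fmax dim-∅ dim-y ∅≼y)) ⟩
    fromℕ (Fmax X -1ℤ 0ℤ (+ d)) * fromℕ (Fmax X 0ℤ 1ℤ (+ d)) ∎

  -- Two factors `Λ` bound the maxima `P₀` and `Q₀` by the corresponding minima, `double-counting`
  -- passes from these to two other maxima, and two more factors `Λ` bring those down to `p₀` and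
  -- `q₀`.
  P₀Q₀≤Λ⁴p₀q₀ : ∀ {Λ} → 0# ≤ Λ → lowerIrregularity X d ≤ Λ → P₀ * Q₀ ≤ (p₀ * q₀) * Λ ^ 4
  P₀Q₀≤Λ⁴p₀q₀ {Λ} 0≤Λ irr≤Λ = begin
    P₀ * Q₀
      ≤⟨ *-mono-≤ (×ℕ1-nonNeg (Fmax X -1ℤ 1ℤ (+ d))) (*-nonNeg (×ℕ1-nonNeg (Fmin X -1ℤ 0ℤ 1ℤ)) 0≤Λ)
           (Fmax≤Λ*Fmin {0} {2} {suc d} z≤n (s≤s 1≤d) ℕ.≤-refl irr≤Λ)
           (Fmax≤Λ*Fmin {0} {1} {2} z≤n (s≤s z≤n) (s≤s 1≤d) irr≤Λ) ⟩
    (m₁ * Λ) * (m₂ * Λ)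
      ≈⟨ solve 3 (λ m₁ m₂ Λ → (m₁ :* Λ) :* (m₂ :* Λ) := (m₁ :* m₂) :* (Λ :* Λ)) ≈-refl m₁ m₂ Λ ⟩
    (m₁ * m₂) * (Λ * Λ)
      ≤⟨ *-monoʳ-≤ (*-nonNeg 0≤Λ 0≤Λ) double-counting ⟩
    (fromℕ (Fmax X -1ℤ 0ℤ (+ d)) * fromℕ (Fmax X 0ℤ 1ℤ (+ d))) * (Λ * Λ)
      ≤⟨ *-monoʳ-≤ (*-nonNeg 0≤Λ 0≤Λ) (*-mono-≤
           (×ℕ1-nonNeg (Fmax X -1ℤ 0ℤ (+ d))) (*-nonNeg (×ℕ1-nonNeg (Fmin X 0ℤ 1ℤ (+ d))) 0≤Λ)
           (Fmax≤Λ*Fmin {0} {1} {suc d} z≤n (s≤s z≤n) ℕ.≤-refl irr≤Λ)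
           (Fmax≤Λ*Fmin {1} {2} {suc d} (s≤s z≤n) (s≤s 1≤d) ℕ.≤-refl irr≤Λ)) ⟩
    ((p₀ * Λ) * (q₀ * Λ)) * (Λ * Λ)
      ≈⟨ solve 3 (λ p q Λ → ((p :* Λ) :* (q :* Λ)) :* (Λ :* Λ) := (p :* q) :* (Λ :^ 4)) ≈-refl p₀ q₀ Λ ⟩
    (p₀ * q₀) * Λ ^ 4 ∎
    where
    m₁ m₂ : Carrier
    m₁ = fromℕ (Fmin X -1ℤ 1ℤ (+ d))
    m₂ = fromℕ (Fmin X -1ℤ 0ℤ 1ℤ)

  p₀-pos : 0# < p₀
  p₀-pos = ×ℕ1-pos (Fmin-pos ℤ.-≤+ (ℤ.+≤+ z≤n))

  q₀-pos : 0# < q₀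
  q₀-pos = ×ℕ1-pos (Fmin-pos (ℤ.+≤+ z≤n) (ℤ.+≤+ 1≤d))

  module _ (w : Face → Carrier) (w-proper : IsProperWeight X d w) where
    open IsProperWeight w-proper

    w-nonNeg : ∀ x → 0# ≤ w x
    w-nonNeg x = proj₁ (positive x)

    topWeight : Face → Carrier
    topWeight z = weight X w (λ y → dim y ≡ + d × z ≼ y)

    topWeight-pos : ∀ z → 0# < topWeight z
    topWeight-pos z with y , dim-y , z≼y ← pure z =
      <-≤-trans (positive y) (term≤sum w-nonNeg (∈-select (dim-y , z≼y)))

    -- The weight of the link of z, extended to all faces.
    w[_] : Face → Face → Carrier
    w[ z ] x = topWeight z ⁻¹ * ∑ X (λ y → dim y ≡ + d × x ≼ y)
      (λ y → w y / fromℕ (∣_∣ X (chain (dim x) z y)))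

    w[]-nonNeg : ∀ z x → 0# ≤ w[ z ] x
    w[]-nonNeg z x = *-nonNeg (⁻¹-nonNeg (proj₁ (topWeight-pos z)))
      (sum-nonNeg (select X (λ y → dim y ≡ + d × x ≼ y)) λ {y} _ →
        /-nonNeg (w-nonNeg y) (×ℕ1-nonNeg (∣_∣ X (chain (dim x) z y))))

    -- The face `z` is the only one of its dimension between `z` and a `d`-face, so all denominators
    -- are at most 1 and the sum is at least the normalising `topWeight z`.
    1≤w[z]z : ∀ z → 1# ≤ w[ z ] z
    1≤w[z]z z = begin
      1#                            ≈⟨ ⁻¹-inverseˡ (0<x⇒x≉0 (topWeight-pos z)) ⟨
      topWeight z ⁻¹ * topWeight z  ≤⟨ *-monoˡ-≤ (⁻¹-nonNeg (proj₁ (topWeight-pos z))) (∑-mono-≤ le) ⟩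
      w[ z ] z                      ∎
      where
      le : ∀ {y} → dim y ≡ + d × z ≼ y → w y ≤ w y / fromℕ (∣_∣ X (chain (dim z) z y))
      le {y} (dim-y , z≼y) = ≤-trans
        (≤-*-/ {k = 1#} (w-nonNeg y) (×ℕ1-pos (∣∣-pos {x = z} (refl , ≼.refl , z≼y)))
          (≤-trans (×ℕ1-mono-≤ (∣∣≤1 (λ (dim≡ , z≼u , _) → ≼-dim-injective z≼u dim≡)))
                   (≤-reflexive (+-identityʳ 1#))))
        (≤-reflexive (*-identityˡ _))

    -- By `w-≈`, each `d`-face above `v` contributes to `w v` its weight divided by the number of
    -- its vertices, which is at least `p₀`.
    p₀*w≤topWeight : ∀ {v} → dim v ≡ 0ℤ → p₀ * w v ≤ topWeight v
    p₀*w≤topWeight {v} dim-v = begin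
      p₀ * w v                               ≈⟨ *-congˡ (w-≈ v) ⟩
      p₀ * ∑ X above (λ y → w y / fromℕ (n y)) ≈⟨ *-distribˡ-sum p₀ (select X above) _ ⟩
      ∑ X above (λ y → p₀ * (w y / fromℕ (n y)))
        ≤⟨ ∑-mono-≤ (λ {y} (dim-y , v≼y) → *-/-≤ (w-nonNeg y)
             (×ℕ1-pos (∣∣-pos {x = v} (refl , v≼y)))
             (×ℕ1-mono-≤ (ℕ.≤-trans (Fmin≤ dim-∅ dim-y (∅-least y))
               (∣∣-mono (λ (dim-u , _ , u≼y) → ≡.trans dim-u (≡.sym dim-v) , u≼y))))) ⟩
      topWeight v                            ∎
      where
      above : Pred Face _
      above y = dim y ≡ + d × v ≼ y
      n : Face → ℕ
      n y = ∣_∣ X (y ⟨ dim v ⟩)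

    -- The factor `w v` cancels against the normalisation `topWeight v` at the price of `p₀`. The
    -- remaining sums differ in their denominators: edges between `v` and `y`, at least `q₀` in
    -- number, against all edges of `y`, at most `P₀`.
    w[]-bound : ∀ {v e} → dim v ≡ 0ℤ → dim e ≡ 1ℤ → v ≼ e →
                (p₀ * q₀) * (w v * w[ v ] e) ≤ P₀ * w e
    w[]-bound {v} {e} dim-v dim-e v≼e = begin
      (p₀ * q₀) * (w v * (topWeight v ⁻¹ * S))
        ≈⟨ solve 5 (λ p q x y z → (p :* q) :* (x :* (y :* z)) := (p :* x) :* (y :* (q :* z)))
             ≈-refl p₀ q₀ (w v) (topWeight v ⁻¹) S ⟩
      (p₀ * w v) * (topWeight v ⁻¹ * (q₀ * S))
        ≤⟨ *-mono-≤ (*-nonNeg (proj₁ p₀-pos) (w-nonNeg v))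
             (*-nonNeg 0≤W⁻¹ (*-nonNeg (×ℕ1-nonNeg (Fmax X -1ℤ 1ℤ (+ d))) (w-nonNeg e)))
             (p₀*w≤topWeight dim-v) (*-monoˡ-≤ 0≤W⁻¹ q₀S≤) ⟩
      topWeight v * (topWeight v ⁻¹ * (P₀ * w e))
        ≈⟨ *-assoc _ _ _ ⟨
      (topWeight v * topWeight v ⁻¹) * (P₀ * w e)
        ≈⟨ *-congʳ (⁻¹-inverseʳ (0<x⇒x≉0 (topWeight-pos v))) ⟩
      1# * (P₀ * w e)
        ≈⟨ *-identityˡ _ ⟩
      P₀ * w e ∎
      where
      above : Pred Face _
      above y = dim y ≡ + d × e ≼ y
      S : Carrier
      S = ∑ X above (λ y → w y / fromℕ (∣_∣ X (chain (dim e) v y)))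
      0≤W⁻¹ : 0# ≤ topWeight v ⁻¹
      0≤W⁻¹ = ⁻¹-nonNeg (proj₁ (topWeight-pos v))
      q₀S≤ : q₀ * S ≤ P₀ * w e
      q₀S≤ = begin
        q₀ * S
          ≈⟨ *-distribˡ-sum q₀ (select X above) _ ⟩
        ∑ X above (λ y → q₀ * (w y / fromℕ (∣_∣ X (chain (dim e) v y))))
          ≤⟨ ∑-mono-≤ (λ {y} (dim-y , e≼y) → ≤-trans
               (*-/-≤ (w-nonNeg y) (×ℕ1-pos (∣∣-pos {x = e} (refl , v≼e , e≼y)))
                 (×ℕ1-mono-≤ (ℕ.≤-trans (Fmin≤ dim-v dim-y (≼.trans v≼e e≼y))
                   (∣∣-mono (λ (dim-u , v≼u≼y) → ≡.trans dim-u (≡.sym dim-e) , v≼u≼y)))))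
               (≤-*-/ (w-nonNeg y) (×ℕ1-pos (∣∣-pos {x = e} (refl , e≼y)))
                 (×ℕ1-mono-≤ (ℕ.≤-trans
                   (∣∣-mono (λ (dim-u , u≼y) → ≡.trans dim-u dim-e , ∅-least _ , u≼y))
                   (≤Fmax dim-∅ dim-y (∅-least y)))))) ⟩
        ∑ X above (λ y → P₀ * (w y / fromℕ (∣_∣ X (y ⟨ dim e ⟩))))
          ≈⟨ *-distribˡ-sum P₀ (select X above) _ ⟨
        P₀ * ∑ X above (λ y → w y / fromℕ (∣_∣ X (y ⟨ dim e ⟩)))
          ≈⟨ *-congˡ (w-≈ e) ⟨
        P₀ * w e ∎

    -- Summing the local bounds over `A` with `w[]-bound` counts an edge of `B` once for each of its
    -- vertices in `A`, hence at most `Q₀` times. The resulting factor `P₀ * Q₀ / (p₀ * q₀)` is at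
    -- most `Λ ^ 4`.
    local-to-global : ∀ {A : Pred Face p} {B : Pred Face q} {ε Λ} →
      (∀ {x} → A x → dim x ≡ 0ℤ) → (∀ {e} → B e → dim e ≡ 1ℤ) →
      0# ≤ Λ → lowerIrregularity X d ≤ Λ →
      (∀ {v} → A v → ε ≤ ∑ X (λ e → B e × v ≼ e) w[ v ]) →
      weight X w A * ε ≤ Λ ^ 4 * weight X w B
    local-to-global {A = A} {B} {ε} {Λ} A₀ B₁ 0≤Λ irr≤Λ ε≤ = *-cancelˡ-≤ (*-pos p₀-pos q₀-pos) (begin
      (p₀ * q₀) * (weight X w A * ε)
        ≈⟨ solve 3 (λ x y z → x :* (y :* z) := (x :* z) :* y) ≈-refl (p₀ * q₀) (weight X w A) ε ⟩
      ((p₀ * q₀) * ε) * weight X w A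
        ≈⟨ *-distribˡ-sum _ (select X A) w ⟩
      ∑ X A (λ v → ((p₀ * q₀) * ε) * w v)
        ≤⟨ ∑-mono-≤ at-vertex ⟩
      ∑ X A (λ v → ∑ X (λ e → B e × v ≼ e) (λ e → P₀ * w e))
        ≈⟨ ∑-swap (λ (v∈A , e∈B , v≼e) → e∈B , v∈A , v≼e) (λ (e∈B , v∈A , v≼e) → v∈A , e∈B , v≼e)
             (λ _ e → P₀ * w e) ⟩
      ∑ X B (λ e → ∑ X (λ v → A v × v ≼ e) (λ _ → P₀ * w e))
        ≤⟨ ∑-mono-≤ (λ {e} e∈B → ≤-trans (≤-reflexive (sum-const _ (select X (λ v → A v × v ≼ e))))
             (*-monoʳ-≤ (*-nonNeg (×ℕ1-nonNeg (Fmax X -1ℤ 1ℤ (+ d))) (w-nonNeg e)) (×ℕ1-mono-≤ (ℕ.≤-trans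
               (∣∣-mono (λ (v∈A , v≼e) → A₀ v∈A , ∅-least _ , v≼e))
               (≤Fmax dim-∅ (B₁ e∈B) (∅-least e)))))) ⟩
      ∑ X B (λ e → Q₀ * (P₀ * w e))
        ≤⟨ ∑-mono-≤ (λ {e} _ → ≤-reflexive
             (solve 3 (λ x y z → x :* (y :* z) := (y :* x) :* z) ≈-refl Q₀ P₀ (w e))) ⟩
      ∑ X B (λ e → (P₀ * Q₀) * w e)
        ≈⟨ *-distribˡ-sum _ (select X B) w ⟨
      (P₀ * Q₀) * weight X w B
        ≤⟨ *-monoʳ-≤ (sum-nonNeg (select X B) (λ {e} _ → w-nonNeg e)) (P₀Q₀≤Λ⁴p₀q₀ 0≤Λ irr≤Λ) ⟩
      ((p₀ * q₀) * Λ ^ 4) * weight X w B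
        ≈⟨ *-assoc _ _ _ ⟩
      (p₀ * q₀) * (Λ ^ 4 * weight X w B) ∎)
      where
      at-vertex : ∀ {v} → A v → ((p₀ * q₀) * ε) * w v ≤ ∑ X (λ e → B e × v ≼ e) (λ e → P₀ * w e)
      at-vertex {v} v∈A = begin
        ((p₀ * q₀) * ε) * w v
          ≈⟨ solve 3 (λ x y z → (x :* y) :* z := (x :* z) :* y) ≈-refl (p₀ * q₀) ε (w v) ⟩
        ((p₀ * q₀) * w v) * ε
          ≤⟨ *-monoˡ-≤ (*-nonNeg (proj₁ (*-pos p₀-pos q₀-pos)) (w-nonNeg v)) (ε≤ v∈A) ⟩
        ((p₀ * q₀) * w v) * ∑ X (λ e → B e × v ≼ e) w[ v ]
          ≈⟨ *-distribˡ-sum _ (select X (λ e → B e × v ≼ e)) w[ v ] ⟩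
        ∑ X (λ e → B e × v ≼ e) (λ e → ((p₀ * q₀) * w v) * w[ v ] e)
          ≤⟨ ∑-mono-≤ (λ (e∈B , v≼e) → ≤-trans (≤-reflexive (*-assoc _ _ _)) (w[]-bound (A₀ v∈A) (B₁ e∈B) v≼e)) ⟩
        ∑ X (λ e → B e × v ≼ e) (λ e → P₀ * w e) ∎

-- Cocycles of degree 0 and their restrictions to links.

module Cohomology (lem : ∀ {p} → ExcludedMiddle p) (ℝ : CompleteOrderedField c ℓ₁ ℓ₂)
  {d} (1≤d : 1 ℕ.≤ d) (X : GradedPoset a ℓ) (X-d : IsDPoset d X)
  (w : GradedPoset.Face X → CompleteOrderedField.Carrier ℝ)
  (w-proper : Expansion.IsProperWeight lem ℝ X d w)
  {R : CommutativeRing r ℓr} (inc : Expansion.Incidence lem ℝ R X) (𝓕 : Sheaf R X m ℓm) where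
  open CompleteOrderedField ℝ hiding (refl; sym; trans)
  open CompleteOrderedField ℝ using () renaming (refl to ≈-refl; sym to ≈-sym; trans to ≈-trans)
  open OrderedField ℝ
  open ExpansionProperties lem ℝ
  open Expansion lem ℝ hiding (_≈_; _≤_; _<_; _+_; _*_; _-_; _^_; 0#; 1#)
  open Intervals lem X
  open Weighted lem ℝ 1≤d X X-d
  open GradedPoset X
  open IsDPoset X-d
  open ≤-Reasoning
  open SemiringSolver commutativeSemiring using (solve; _:=_; _:+_; _:*_; _:^_)
  open Sheaf 𝓕
  private
    module ≼ = IsPartialOrder isPartialOrder
    module R = CommutativeRing R
    module 𝓕 x = Module (stalk x)
    module res {x y} .(x≺y : x ≺ y) = ModuleMorphisms.IsModuleHomomorphism (res-linear x≺y)
    module Σ𝓕 x = Sums (𝓕.+ᴹ-commutativeMonoid x)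

  -- One summand of `δ`, named so that its vanishing can be discussed on its own; the coboundary in
  -- a link has summands of the same form.
  δ-term : ∀ {i} → Cochain X inc 𝓕 i → ∀ y → .(dim y ≡ ℤ.suc i) → Refinement Face (y ⟨ i ⟩) → Section y
  δ-term f y dim-y (x , [ x∈y ]) = 𝓕._*ₗ_ y (inc y x)
    (res (≼⇒≺ (proj₁ x∈y) dim-y (proj₂ x∈y)) (f (x , [ proj₁ x∈y ])))

  res-0 : ∀ {x y} .(x≺y : x ≺ y) {s} → 𝓕._≈ᴹ_ x s (𝓕.0ᴹ x) → 𝓕._≈ᴹ_ y (res x≺y s) (𝓕.0ᴹ y)
  res-0 {y = y} x≺y s≈0 = 𝓕.≈ᴹ-trans y (res.⟦⟧-cong x≺y s≈0) (res.0ᴹ-homo x≺y)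

  δ-term-0 : ∀ {i} (f : Cochain X inc 𝓕 i) y .(dim-y : dim y ≡ ℤ.suc i) x .(x∈y : (y ⟨ i ⟩) x) →
             𝓕._≈ᴹ_ x (f (x , [ proj₁ x∈y ])) (𝓕.0ᴹ x) →
             𝓕._≈ᴹ_ y (δ-term f y dim-y (x , [ x∈y ])) (𝓕.0ᴹ y)
  δ-term-0 f y dim-y x x∈y fx≈0 = 𝓕.≈ᴹ-trans y
    (𝓕.*ₗ-cong y R.refl (res-0 (≼⇒≺ (proj₁ x∈y) dim-y (proj₂ x∈y)) fx≈0))
    (𝓕.*ₗ-zeroʳ y (inc y x))

  coboundary-0 : IsCoboundary X inc 𝓕 {0ℤ} (0ᶜ X inc 𝓕)
  coboundary-0 = 0ᶜ X inc 𝓕 , λ (y , [ dim-y ]) →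
    Σ𝓕.sum-ε y (enumerate (λ _ → lem) faces)
      (λ {(x , [ x∈y ])} _ → δ-term-0 (0ᶜ X inc 𝓕) y dim-y x x∈y (𝓕.≈ᴹ-refl x))

  -- A cochain that vanishes everywhere is the coboundary of the zero cochain. This is what makes
  -- `‖ f ‖` positive.
  supp-nonempty : (f : Cochain X inc 𝓕 0ℤ) → ¬ IsCoboundary X inc 𝓕 f → ∃ (supp X inc 𝓕 f)
  supp-nonempty f f∉B with lem {P = ∃ (supp X inc 𝓕 f)}
  ... | yes nonempty = nonempty
  ... | no  empty    = contradiction (proj₁ coboundary-0 , λ x →
      𝓕.≈ᴹ-trans (value x) (proj₂ coboundary-0 x) (𝓕.≈ᴹ-sym (value x) (f≈0 x))) f∉B
    where
    f≈0 : _≈ᶜ_ X inc 𝓕 f (0ᶜ X inc 𝓕)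
    f≈0 (x , [ dim-x ]) with lem {P = 𝓕._≈ᴹ_ x (f (x , [ dim-x ])) (𝓕.0ᴹ x)}
    ... | yes fx≈0 = fx≈0
    ... | no  fx≉0 = contradiction (x , recompute (dim x ℤ.≟ 0ℤ) dim-x , fx≉0) empty

  -- In a vanishing sum a nonzero term is never the only one.
  another-term : (f : Cochain X inc 𝓕 0ℤ) → IsCocycle X inc 𝓕 f →
    ∀ {y x} .(dim-y : dim y ≡ 1ℤ) (x∈y : (y ⟨ 0ℤ ⟩) x) →
    ¬ 𝓕._≈ᴹ_ y (δ-term f y dim-y (x , [ x∈y ])) (𝓕.0ᴹ y) →
    ∃[ u ] u ≢ x × supp X inc 𝓕 f u × u ≼ y
  another-term f δf≈0 {y} {x} dim-y x∈y term≉0 with lem {P = ∃[ u ] u ≢ x × supp X inc 𝓕 f u × u ≼ y}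
  ... | yes another = another
  ... | no  none    = contradiction (𝓕.≈ᴹ-trans y (𝓕.≈ᴹ-sym y δf≈term) (δf≈0 (y , [ dim-y ]))) term≉0
    where
    others : ∀ {u} → u ≢ (x , [ x∈y ]) → 𝓕._≈ᴹ_ y (δ-term f y dim-y u) (𝓕.0ᴹ y)
    others {u , [ u∈y ]} u≢x with lem {P = 𝓕._≈ᴹ_ u (f (u , [ proj₁ u∈y ])) (𝓕.0ᴹ u)}
    ... | yes fu≈0 = δ-term-0 f y dim-y u u∈y fu≈0
    ... | no  fu≉0 with dim-u , u≼y ← recompute (lem {P = (y ⟨ 0ℤ ⟩) u}) u∈y =
      contradiction (u , u≢x ∘ value-injective , (dim-u , fu≉0) , u≼y) none
    δf≈term : 𝓕._≈ᴹ_ y (δ X inc 𝓕 0ℤ f (y , [ dim-y ])) (δ-term f y dim-y (x , [ x∈y ]))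
    δf≈term = Σ𝓕.sum-single y (enumerate-unique (λ _ → lem) faces-unique)
      (∈-enumerate (λ _ → lem) _ (faces-complete x)) others

  -- The link of a vertex in degree -1.

  module Link {v} (dim-v : dim v ≡ 0ℤ) where
    Xᵥ = link X v
    incᵥ = linkIncidence {R = R} X inc v
    𝓕ᵥ = linkSheaf X 𝓕 v
    wᵥ = linkWeight X d w v

    v̂ : GradedPoset.Face Xᵥ
    v̂ = v , [ ≼.refl ]

    dim-v̂ : GradedPoset.dim Xᵥ v̂ ≡ -1ℤ
    dim-v̂ = ≡.cong (ℤ._- 1ℤ) (ℤ.+-inverseʳ (dim v))

    dim-value : ∀ {x i} → GradedPoset.dim Xᵥ x ≡ i → dim (value x) ≡ ℤ.suc i
    dim-value {x , _} refl rewrite dim-v = ≡.sym (≡.trans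
      (≡.cong ℤ.suc (≡.trans (≡.cong (ℤ._- 1ℤ) (ℤ.+-identityʳ (dim x))) (ℤ.+-comm (dim x) -1ℤ)))
      (ℤ.suc-pred (dim x)))

    -- Such a face would have dimension -1 in `X` and yet lie above `v`, which has dimension 0.
    no-faces-below : ∀ {x} → GradedPoset.dim Xᵥ x ≢ ℤ.pred -1ℤ
    no-faces-below {x , [ v≼x ]} dim-x
      with () ← ≡.subst₂ ℤ._≤_ dim-v (dim-value {x , [ v≼x ]} dim-x) (dim-mono (recompute lem v≼x))

    -- The sum defining a coboundary at `v̂` runs over faces of dimension -2, of which the link has
    -- none.
    B⁻¹-trivial : ∀ {g : Cochain Xᵥ incᵥ 𝓕ᵥ -1ℤ} → IsCoboundary Xᵥ incᵥ 𝓕ᵥ g →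
                  𝓕._≈ᴹ_ v (g (v̂ , [ dim-v̂ ])) (𝓕.0ᴹ v)
    B⁻¹-trivial (h , δh≈g) = 𝓕.≈ᴹ-trans v (𝓕.≈ᴹ-sym v (δh≈g _))
      (Σ𝓕.sum-ε v (enumerate (λ _ → lem) (GradedPoset.faces Xᵥ))
        λ {(u , [ u∈v̂ ])} _ → ⊥-elim-irr (no-faces-below {u} (proj₁ u∈v̂)))

    -- Coboundaries vanish at `v̂` and `g` does not, so `v̂` lies in the support of the difference,
    -- and its link weight is at least 1.
    1≤dist : ∀ {g h : Cochain Xᵥ incᵥ 𝓕ᵥ -1ℤ} → ¬ 𝓕._≈ᴹ_ v (g (v̂ , [ dim-v̂ ])) (𝓕.0ᴹ v) →
             IsCoboundary Xᵥ incᵥ 𝓕ᵥ h → 1# ≤ dist Xᵥ incᵥ 𝓕ᵥ wᵥ g h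
    1≤dist {g} {h} gv≉0 h∈B = ≤-trans (1≤w[z]z w w-proper v)
      (term≤sum {f = λ x → w[_] w w-proper v (value x)} (λ x → w[]-nonNeg w w-proper v (value x))
        (∈-filter⁺ (λ _ → lem) (GradedPoset.faces-complete Xᵥ v̂)
          (dim-v̂ , λ g-h≈0 → gv≉0 (𝓕.≈ᴹ-trans v
            (x∙y⁻¹≈ε⇒x≈y _ _ g-h≈0) (B⁻¹-trivial h∈B)))))
      where open GroupProperties (𝓕.+ᴹ-group v) using (x∙y⁻¹≈ε⇒x≈y)

    1≤distToCoboundaries : ∀ {g : Cochain Xᵥ incᵥ 𝓕ᵥ -1ℤ} → ¬ 𝓕._≈ᴹ_ v (g (v̂ , [ dim-v̂ ])) (𝓕.0ᴹ v) →
                           1# ≤ distToCoboundaries Xᵥ incᵥ 𝓕ᵥ wᵥ g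
    1≤distToCoboundaries {g} gv≉0 = ≤-⋀
      -- `≤-⋀` asks for a member of the set of distances: the coboundary of the zero cochain
      -- supplies one.
      (_ , δ⁻ Xᵥ incᵥ 𝓕ᵥ -1ℤ h , (h , λ x → 𝓕.≈ᴹ-refl (value (value x))) , ≈-refl)
      (λ t (h , h∈B , t≈dist) → ≤-respʳ-≈ (≈-sym t≈dist) (1≤dist {g} {h} gv≉0 h∈B))
      where
      h : Cochain Xᵥ incᵥ 𝓕ᵥ (ℤ.pred -1ℤ)
      h = 0ᶜ Xᵥ incᵥ 𝓕ᵥ

    -- Faces of dimension -1 in the link have dimension 0 in `X` and lie above `v`, so `v` is the
    -- only one: this cochain amounts to the value `f v`.
    restrict : Cochain X inc 𝓕 0ℤ → Cochain Xᵥ incᵥ 𝓕ᵥ -1ℤ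
    restrict f (x , [ dim-x ]) = f (value x , [ dim-value {x} dim-x ])

  ‖‖-nonNeg : ∀ {i} (f : Cochain X inc 𝓕 i) → 0# ≤ ‖_‖ X inc 𝓕 w f
  ‖‖-nonNeg f = sum-nonNeg (select X (supp X inc 𝓕 f)) (λ {x} _ → w-nonNeg w w-proper x)

  -- The edge set `E₂`, in the form used by `SkeletonExpander`.
  doubleEdges : Pred Face p → Pred Face _
  doubleEdges A e = dim e ≡ 1ℤ × (∃[ x ] ∃[ y ] x ≢ y × A x × A y × x ≼ e × y ≼ e)

  module _ (f : Cochain X inc 𝓕 0ℤ) (δf≈0 : IsCocycle X inc 𝓕 f) where

    module _ {v} (dim-v : dim v ≡ 0ℤ) where
      open Link dim-v

      -- A nonzero coboundary in the link has a nonzero term. This is also a term of `δ f` at `e`,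
      -- which vanishes, so `another-term` yields a second vertex of `e` in the support.
      supp-δ-restrict : ∀ {e} → supp Xᵥ incᵥ 𝓕ᵥ (δ Xᵥ incᵥ 𝓕ᵥ -1ℤ (restrict f)) e →
                        doubleEdges (supp X inc 𝓕 f) (value e) × v ≼ value e
      supp-δ-restrict {ê@(e , [ v≼e ])} (dim-ê , δ≉0) =
        from-term (lem {P = ∃[ x ] ¬ 𝓕._≈ᴹ_ e (link-term x) (𝓕.0ᴹ e)})
        where
        dim-e : dim e ≡ 1ℤ
        dim-e = dim-value {ê} dim-ê
        ∈e : ∀ {x̂} → GradedPoset._⟨_⟩ Xᵥ ê -1ℤ x̂ → (e ⟨ 0ℤ ⟩) (value x̂)
        ∈e {x̂} (dim-x̂ , x≼e) = dim-value {x̂} dim-x̂ , x≼e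
        link-term : Refinement (GradedPoset.Face Xᵥ) (GradedPoset._⟨_⟩ Xᵥ ê -1ℤ) → Section e
        link-term (x̂ , [ x̂∈ê ]) = δ-term f e dim-e (value x̂ , [ ∈e {x̂} x̂∈ê ])
        from-term : Dec (∃[ x ] ¬ 𝓕._≈ᴹ_ e (link-term x) (𝓕.0ᴹ e)) → doubleEdges (supp X inc 𝓕 f) e × v ≼ e
        from-term (no none) = contradiction
          (Σ𝓕.sum-ε e (enumerate (λ _ → lem) (GradedPoset.faces Xᵥ))
            λ {x} _ → decidable-stable lem (λ x≉0 → none (x , x≉0)))
          δ≉0
        from-term (yes ((x̂@(x , _) , [ x̂∈ê ]) , term≉0))
          with x∈e ← recompute (lem {P = (e ⟨ 0ℤ ⟩) x}) (∈e {x̂} x̂∈ê)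
          with u , u≢x , u∈supp , u≼e ← another-term f δf≈0 dim-e x∈e term≉0 =
          (dim-e , u , x , u≢x , u∈supp , (proj₁ x∈e , λ fx≈0 → term≉0 (δ-term-0 f e dim-e x x∈e fx≈0)) ,
            u≼e , proj₂ x∈e) ,
          recompute lem v≼e

      ε≤w[v] : ∀ {ε} → supp X inc 𝓕 f v → [ ε ] ≤⁺ cbe Xᵥ incᵥ 𝓕ᵥ wᵥ -1ℤ →
               ε ≤ ∑ X (λ e → doubleEdges (supp X inc 𝓕 f) e × v ≼ e) (w[_] w w-proper v)
      ε≤w[v] (_ , fv≉0) = ≤-sup⁺⇒≤
        (λ μ (0≤μ , μ-bound) → begin
          μ                                                     ≈⟨ *-identityʳ μ ⟨
          μ * 1#                                                ≤⟨ *-monoˡ-≤ 0≤μ (1≤distToCoboundaries {restrict f} fv≉0) ⟩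
          μ * distToCoboundaries Xᵥ incᵥ 𝓕ᵥ wᵥ (restrict f)      ≤⟨ μ-bound (restrict f) ⟩
          ‖_‖ Xᵥ incᵥ 𝓕ᵥ wᵥ (δ Xᵥ incᵥ 𝓕ᵥ -1ℤ (restrict f))
            ≤⟨ sum-filter-enumerate (λ _ → lem) (λ _ → lem) (λ _ → lem) (λ {e} → supp-δ-restrict {e}) faces
                 (w[_] w w-proper v) (w[]-nonNeg w w-proper v) ⟩
          ∑ X (λ e → doubleEdges (supp X inc 𝓕 f) e × v ≼ e) (w[_] w w-proper v) ∎)
        (sum-nonNeg (select X (λ e → doubleEdges (supp X inc 𝓕 f) e × v ≼ e))
          (λ {e} _ → w[]-nonNeg w w-proper v e))

    -- Apply `local-to-global` to the support of `f` and to `E₂`, bound the weight of `E₂` by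
    -- skeleton expansion, and divide by the positive `‖ f ‖`.
    ε≤Λ⁴[α+β‖f‖] : ∀ {Λ ε α β} → ¬ IsCoboundary X inc 𝓕 f → 0# ≤ Λ → lowerIrregularity X d ≤ Λ →
      (∀ v → dim v ≡ 0ℤ → [ ε ] ≤⁺ cbe (link X v) (linkIncidence {R = R} X inc v) (linkSheaf X 𝓕 v)
                                        (linkWeight X d w v) -1ℤ) →
      SkeletonExpander X w α β →
      ε ≤ Λ ^ 4 * (α + β * ‖_‖ X inc 𝓕 w f)
    ε≤Λ⁴[α+β‖f‖] {Λ} {ε} {α} {β} f∉B 0≤Λ irr≤Λ ε≤cbe expander = *-cancelˡ-≤ 0<‖f‖ (begin
      W * ε
        ≤⟨ local-to-global w w-proper proj₁ proj₁ 0≤Λ irr≤Λ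
             (λ v∈supp → ε≤w[v] (proj₁ v∈supp) v∈supp (ε≤cbe _ (proj₁ v∈supp))) ⟩
      Λ ^ 4 * weight X w (doubleEdges (supp X inc 𝓕 f))
        ≤⟨ *-monoˡ-≤ 0≤Λ⁴ (≤-trans
             (sum-filter-mono (λ _ → lem) (λ _ → lem)
               (λ (dim-e , x , y , x≢y , x∈ , y∈ , x≼e , y≼e) →
                 dim-e , x , y , x≢y , fromWitness x∈ , fromWitness y∈ , x≼e , y≼e)
               faces (w-nonNeg w w-proper))
             (expander S (λ x x∈S → proj₁ (toWitness x∈S)))) ⟩
      Λ ^ 4 * (α * weight X w S + β * weight X w S ^ 2)
        ≈⟨ *-congˡ (+-cong (*-congˡ wS≈W) (*-congˡ (*-cong wS≈W (*-congʳ wS≈W)))) ⟩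
      Λ ^ 4 * (α * W + β * W ^ 2)
        ≈⟨ solve 4 (λ l α β W → l :* (α :* W :+ β :* (W :^ 2)) := W :* (l :* (α :+ β :* W))) ≈-refl (Λ ^ 4) α β W ⟩
      W * (Λ ^ 4 * (α + β * W)) ∎)
      where
      W : Carrier
      W = ‖_‖ X inc 𝓕 w f
      -- The support of f at the universe level asked for by SkeletonExpander.
      S : Pred Face 0ℓ
      S x = True (lem {P = supp X inc 𝓕 f x})
      wS≈W : weight X w S ≈ W
      wS≈W = ≤-antisym
        (sum-filter-mono (λ _ → lem) (λ _ → lem) toWitness faces (w-nonNeg w w-proper))
        (sum-filter-mono (λ _ → lem) (λ _ → lem) fromWitness faces (w-nonNeg w w-proper))
      0<‖f‖ : 0# < W
      0<‖f‖ with x , x∈supp ← supp-nonempty f f∉B =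
        <-≤-trans (IsProperWeight.positive w-proper x) (term≤sum (w-nonNeg w w-proper) (∈-select x∈supp))
      0≤Λ⁴ : 0# ≤ Λ ^ 4
      0≤Λ⁴ = ^-nonNeg 0≤Λ 4

-- The constants depending on `L` and the final inequality.

module Constants (lem : ∀ {p} → ExcludedMiddle p) (ℝ : CompleteOrderedField c ℓ₁ ℓ₂) where
  open CompleteOrderedField ℝ hiding (refl; sym; trans)
  open CompleteOrderedField ℝ using () renaming (refl to ≈-refl; sym to ≈-sym; trans to ≈-trans)
  open OrderedField ℝ
  open ExpansionProperties lem ℝ
  open Expansion lem ℝ using (_⁻¹; _/_)
  open ≤-Reasoning
  open SemiringSolver commutativeSemiring using (solve; _:=_; _:*_; _:^_)

  1≤^ : ∀ {x} → 1# ≤ x → ∀ n → 1# ≤ x ^ n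
  1≤^ 1≤x zero    = ≤-refl
  1≤^ 1≤x (suc n) = ≤-trans (≤-reflexive (≈-sym (*-identityˡ 1#)))
    (*-mono-≤ 0≤1 (≤-trans 0≤1 (1≤^ 1≤x n)) 1≤x (1≤^ 1≤x n))

  ^-pos : ∀ {x} → 1# ≤ x → ∀ n → 0# < x ^ n
  ^-pos 1≤x n = <-≤-trans 0<1 (1≤^ 1≤x n)

  x⁻¹≤1 : ∀ {x} → 1# ≤ x → x ⁻¹ ≤ 1#
  x⁻¹≤1 {x} 1≤x = *-cancelˡ-≤ 0<x (begin
    x * x ⁻¹ ≈⟨ ⁻¹-inverseʳ (0<x⇒x≉0 0<x) ⟩
    1#       ≤⟨ 1≤x ⟩
    x        ≈⟨ *-identityʳ x ⟨
    x * 1#   ∎)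
    where
    0<x : 0# < x
    0<x = <-≤-trans 0<1 1≤x

  -- The estimate costs a factor `L ^ 4`, which is at most `L ^ 8` because `L ^ 4` is at least 1.
  L⁻⁸L⁴≤1 : ∀ {L} → 1# ≤ L → (L ^ 8) ⁻¹ * L ^ 4 ≤ 1#
  L⁻⁸L⁴≤1 {L} 1≤L = begin
    (L ^ 8) ⁻¹ * L ^ 4           ≈⟨ *-congˡ (*-identityˡ _) ⟨
    (L ^ 8) ⁻¹ * (1# * L ^ 4)    ≤⟨ *-monoˡ-≤ (⁻¹-nonNeg (proj₁ (^-pos 1≤L 8)))
                                     (*-monoʳ-≤ (proj₁ (^-pos 1≤L 4)) (1≤^ 1≤L 4)) ⟩
    (L ^ 8) ⁻¹ * (L ^ 4 * L ^ 4) ≈⟨ *-congˡ (solve 1 (λ L → (L :^ 4) :* (L :^ 4) := L :^ 8) ≈-refl L) ⟩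
    (L ^ 8) ⁻¹ * L ^ 8           ≈⟨ ⁻¹-inverseˡ (0<x⇒x≉0 (^-pos 1≤L 8)) ⟩
    1#                           ∎

  -- Multiplying the last hypothesis by `E` and using `E * K ≤ 1#` gives `E * ε - α ≤ β * W`.
  bound : ∀ {E E′ K ε α β W} → 0# ≤ E → E * K ≤ 1# → 0# ≤ E′ → E′ ≤ 1# → 0# ≤ α → 0# < β → 0# ≤ W →
          ε ≤ K * (α + β * W) → (E′ * (E * ε - α)) / β ≤ W
  bound {E} {E′} {K} {ε} {α} {β} {W} 0≤E EK≤1 0≤E′ E′≤1 0≤α 0<β 0≤W ε≤ = ≤*⇒/≤ 0<β (begin
    E′ * (E * ε - α)  ≤⟨ *-monoˡ-≤ 0≤E′ (x≤y+z⇒x-z≤y Eε≤) ⟩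
    -- `E′ ≤ 1#` is applied to the nonnegative `β * W`, since `E * ε - α` may be negative.
    E′ * (β * W)      ≤⟨ *-monoʳ-≤ 0≤βW E′≤1 ⟩
    1# * (β * W)      ≈⟨ *-identityˡ _ ⟩
    β * W             ∎)
    where
    0≤βW : 0# ≤ β * W
    0≤βW = *-nonNeg (proj₁ 0<β) 0≤W
    0≤βW+α : 0# ≤ β * W + α
    0≤βW+α = ≤-respˡ-≈ (+-identityˡ 0#) (+-mono-≤ 0≤βW 0≤α)
    Eε≤ : E * ε ≤ β * W + α
    Eε≤ = begin
      E * ε                  ≤⟨ *-monoˡ-≤ 0≤E ε≤ ⟩
      E * (K * (α + β * W))  ≈⟨ *-congˡ (*-congˡ (+-comm α (β * W))) ⟩
      E * (K * (β * W + α))  ≈⟨ *-assoc E K _ ⟨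
      E * K * (β * W + α)    ≤⟨ *-monoʳ-≤ 0≤βW+α EK≤1 ⟩
      1# * (β * W + α)       ≈⟨ *-identityˡ _ ⟩
      β * W + α              ∎

theorem8p13 : ∀ {c ℓ₁ ℓ₂ r ℓr a ℓ m ℓm : Level}
    (lem : ∀ {p} → ExcludedMiddle p) (ℝ : CompleteOrderedField c ℓ₁ ℓ₂) →
    let open Expansion lem ℝ in
    (F : ℕ) (L : Real) → 1# ≤ L →
    ∃₂ λ (E E‴ : Real) →
    0# < E × 0# < E‴ × E ≈ (L ^ 8) ⁻¹ × E‴ ≈ (L ^ 3) ⁻¹ ×
    ((R : CommutativeRing r ℓr) (d : ℕ) → 1 ℕ.≤ d →
    (X : GradedPoset a ℓ) → IsDPoset d X →
    let open GradedPoset X in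
    (w : Face → Real) → IsProperWeight X d w →
    (inc : Incidence R X) → IsOrientation R X inc →
    lowerIrregularity X d ≤ L →
    (∀ e → dim e ≡ 1ℤ → ∣_∣ X (e ⟨ 0ℤ ⟩) ℕ.≤ F) →
    (𝓕 : Sheaf R X m ℓm) (ε α β : Real) → 0# ≤ ε → 0# ≤ α → 0# < β →
    (∀ v → dim v ≡ 0ℤ →
    [ ε ] ≤⁺ cbe (link X v) (linkIncidence {R = R} X inc v) (linkSheaf X 𝓕 v)
    (linkWeight X d w v) -1ℤ) →
    SkeletonExpander X w α β →
    ([ (E‴ * (E * ε - α)) / β ] ≤⁺ ccd X inc 𝓕 w 0ℤ) ×
    (LowerRegular X d → [ (1# * (1# * ε - α)) / β ] ≤⁺ ccd X inc 𝓕 w 0ℤ))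
theorem8p13 lem ℝ F L 1≤L =
  (L ^ 8) ⁻¹ , (L ^ 3) ⁻¹ , ⁻¹-pos (^-pos 1≤L 8) , ⁻¹-pos (^-pos 1≤L 3) , ≈-refl , ≈-refl ,
  λ R d 1≤d X X-d w w-proper inc _ irr≤L _ 𝓕 ε α β _ 0≤α 0<β ε≤cbe expander →
    let open Cohomology lem ℝ 1≤d X X-d w w-proper inc 𝓕
        below : ∀ {Λ E E′} → 0# ≤ Λ → lowerIrregularity X d ≤ Λ → 0# ≤ E → E * Λ ^ 4 ≤ 1# → 0# ≤ E′ → E′ ≤ 1# →
                [ (E′ * (E * ε - α)) / β ] ≤⁺ ccd X inc 𝓕 w 0ℤ
        -- `ccd` is an infimum, so it is enough to bound the norm of each cocycle that is not a
        -- coboundary; without such cocycles it is ∞.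
        below 0≤Λ irr≤Λ 0≤E EΛ⁴≤1 0≤E′ E′≤1 = ≤-inf⁺ λ t (f , f∈Z , f∉B , t≈‖f‖) →
          ≤-respʳ-≈ (≈-sym t≈‖f‖) (bound 0≤E EΛ⁴≤1 0≤E′ E′≤1 0≤α 0<β (‖‖-nonNeg f)
            (ε≤Λ⁴[α+β‖f‖] f f∈Z f∉B 0≤Λ irr≤Λ ε≤cbe expander))
    in below (≤-trans 0≤1 1≤L) irr≤L (⁻¹-nonNeg (proj₁ (^-pos 1≤L 8))) (L⁻⁸L⁴≤1 1≤L)
         (⁻¹-nonNeg (proj₁ (^-pos 1≤L 3))) (x⁻¹≤1 (1≤^ 1≤L 3)) ,
       -- In the lower-regular case 1 itself bounds the irregularity, so `Λ`, `E` and `E′` can all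
       -- be 1.
       λ irr≈1 → below 0≤1 (≤-reflexive irr≈1) 0≤1 1*1⁴≤1 0≤1 ≤-refl
  where
  open Expansion lem ℝ
  open CompleteOrderedField ℝ using () renaming (refl to ≈-refl; sym to ≈-sym)
  open OrderedField ℝ
  open ExpansionProperties lem ℝ
  open Constants lem ℝ
  open SemiringSolver (CompleteOrderedField.commutativeSemiring ℝ) using (solve; _:=_; con; _:*_; _:^_)
  1*1⁴≤1 : 1# * 1# ^ 4 ≤ 1#
  1*1⁴≤1 = ≤-reflexive (solve 0 (con 1 :* (con 1 :^ 4) := con 1) ≈-refl)
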